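{- For every prime $p$ and every positive integer $d$, we have $n(\mathbb{Z}_p^d)\le 5d\cdot f(p,d)$.
   Context: For a finite Abelian group $(\Gamma,+)$, a $\Gamma$-labelling of a digraph $D$ is a map $w\colon A(D)\to\Gamma$, where $A(D)$ is the arc set of $D$. A directed cycle with vertices $v_i$, $i\in\mathbb{Z}_\ell$, and arcs $(v_i,v_{i+1})$, $i\in\mathbb{Z}_\ell$ (directed cycles of length $\ell\ge 2$ are allowed), is zero-sum if $\sum_{i=0}^{\ell-1} w(v_i,v_{i+1})=0$ in $\Gamma$. A complete digraph is a digraph containing both arcs $(x,y)$ and $(y,x)$ for every two distinct vertices $x,y$. $n(\Gamma)$ denotes the smallest positive integer $n$ such that every $\Gamma$-labelling of the complete digraph on $n$ vertices admits a zero-sum directed cycle. For a prime $p$ and $d\in\mathbb{N}$, $f(p,d)$ denotes the smallest positive integer $m$ such that for every collection $B_1,\dots,B_m$ of linear bases of the vector space $\mathbb{Z}_p^d$ over $\mathbb{Z}_p$, the multiset union $B_1\cup\dots\cup B_m$ is an additive basis of $\mathbb{Z}_p^d$, i.e. every element of $\mathbb{Z}_p^d$ is the sum of the elements of some (possibly empty) sub-multiset of $B_1\cup\dots\cup B_m$. -}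

module Defs where

open import Data.Nat using (ℕ; zero; suc; _+_; _*_; _≤_; ∣_-_∣)
open import Data.Nat.Divisibility using (_∣_)
open import Data.Nat.DivMod using (_mod_)
open import Data.Fin using (Fin; toℕ)
open import Data.List using (List; map; allFin)
open import Data.Nat.ListAction using (sum)
open import Data.Bool using (Bool; true; false; if_then_else_)
open import Data.Product using (Σ; ∃; _×_; _,_)
open import Function.Definitions using (Injective)
open import Relation.Binary.PropositionalEquality using (_≡_)

∑ : (m : ℕ) → (Fin m → ℕ) → ℕ
∑ m f = sum (map f (allFin m))

_≡_[mod_] : ℕ → ℕ → ℕ → Set
a ≡ b [mod p ] = p ∣ ∣ a - b ∣

Vec𝔽 : ℕ → ℕ → Set
Vec𝔽 p d = Fin d → Fin p

next : {ℓ : ℕ} → Fin (suc ℓ) → Fin (suc ℓ)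
next {ℓ} i = (suc (toℕ i)) mod (suc ℓ)

-- A ℤ_p^d-labelling of the complete digraph on n vertices:
-- w x y is the label of arc (x,y); the values on the diagonal x = y are
-- never used (there are no loops, and cycles have distinct vertices).
Labelling : ℕ → ℕ → ℕ → Set
Labelling p d n = Fin n → Fin n → Vec𝔽 p d

HasZeroSumCycle : (p d n : ℕ) → Labelling p d n → Set
HasZeroSumCycle p d n w =
  Σ ℕ λ k → Σ (Fin (suc (suc k)) → Fin n) λ v →
    Injective _≡_ _≡_ v ×
    (∀ (c : Fin d) →
       ∑ (suc (suc k)) (λ i → toℕ (w (v i) (v (next i)) c)) ≡ 0 [mod p ])

NProperty : (p d n : ℕ) → Set
NProperty p d n = ∀ (w : Labelling p d n) → HasZeroSumCycle p d n w

IsNOf : (p d N : ℕ) → Set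
IsNOf p d N = 1 ≤ N × NProperty p d N × (∀ m → 1 ≤ m → NProperty p d m → N ≤ m)

lincomb : {p d k : ℕ} → (Fin k → Fin p) → (Fin k → Vec𝔽 p d) → Fin d → ℕ
lincomb {k = k} c b j = ∑ k (λ i → toℕ (c i) * toℕ (b i j))

LinIndependent : (p d k : ℕ) → (Fin k → Vec𝔽 p d) → Set
LinIndependent p d k b =
  ∀ (c : Fin k → Fin p) → (∀ j → lincomb c b j ≡ 0 [mod p ]) → ∀ i → toℕ (c i) ≡ 0

Spanning : (p d k : ℕ) → (Fin k → Vec𝔽 p d) → Set
Spanning p d k b =
  ∀ (x : Vec𝔽 p d) → ∃ λ (c : Fin k → Fin p) → ∀ j → lincomb c b j ≡ toℕ (x j) [mod p ]

IsLinearBasis : (p d : ℕ) → (Fin d → Vec𝔽 p d) → Set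
IsLinearBasis p d b = LinIndependent p d d b × Spanning p d d b

-- the multiset union B_1 ∪ … ∪ B_m (element i of B_t is B t i) is an
-- additive basis: every x is the sum of a sub-multiset
IsAdditiveBasis : (p d m : ℕ) → (Fin m → Fin d → Vec𝔽 p d) → Set
IsAdditiveBasis p d m B =
  ∀ (x : Vec𝔽 p d) → ∃ λ (s : Fin m → Fin d → Bool) → ∀ j →
    ∑ m (λ t → ∑ d (λ i → if s t i then toℕ (B t i j) else 0)) ≡ toℕ (x j) [mod p ]

FProperty : (p d m : ℕ) → Set
FProperty p d m = ∀ (B : Fin m → Fin d → Vec𝔽 p d) →
  (∀ t → IsLinearBasis p d (B t)) → IsAdditiveBasis p d m B

IsFOf : (p d M : ℕ) → Set
IsFOf p d M = 1 ≤ M × FProperty p d M × (∀ m → 1 ≤ m → FProperty p d m → M ≤ m)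

{-# OPTIONS --safe #-}
module Submission where

-- A gadget is a triple of distinct vertices (a, b, c); replacing the arc ac by
-- the path abc changes the weight of a walk by w(ab) + w(bc) - w(ac). Suppose
-- that all gadgets avoiding a vertex set F have their differences in Span b.
-- Then every cycle avoiding F has its weight in Span b. If disjoint gadgets
-- avoiding F supply M bases of Span b, a cycle through all of them can
-- be corrected to weight zero by the property defining f(p,d). Otherwise an
-- alternating search as in Haxell's matching theorem, for the direct sum of M
-- copies of the linear matroid, yields K with fewer than M |b| gadgets and F'
-- with |F'| + 5|K| + 5 ≤ |F| + 5M|b| such that in each copy the gadgets
-- avoiding F' lie in the closure of K. The copy with the smallest part of K
-- gives a smaller b, and one repeats. The constant 5 is 2 · 3 - 1 for gadgets
-- of 3 vertices.

open import Defs
open import Data.Bool using (Bool; true; false; if_then_else_)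
open import Data.Fin using (Fin; zero; suc; toℕ; fromℕ<; fromℕ; inject₁)
import Data.Fin.Properties as Fin
open import Data.Integer using (ℤ; +_; 0ℤ; 1ℤ)
import Data.Integer as ℤ
import Data.Integer.DivMod as ℤ
open import Data.Integer.Divisibility.Signed using (_∣_; divides; _∣?_; ∣ᵤ⇒∣; ∣⇒∣ᵤ; ∣m∣n⇒∣m+n; ∣m∣n⇒∣m-n; ∣n⇒∣m*n; ∣m⇒∣m*n; ∣m+n∣m⇒∣n)
import Data.Integer.Properties as ℤ
import Data.Integer.Tactic.RingSolver as ℤRing
open import Data.List using (List; []; _∷_; _++_; _ʳ++_; length; reverse; filter; concatMap; map; allFin; lookup)
open import Data.List.Membership.Propositional using (_∈_; _∉_; find)
open import Data.List.Membership.Propositional.Properties using (∈-++⁺ˡ; ∈-++⁺ʳ; ∈-++⁻; ∈-filter⁺; ∈-filter⁻; ∈-concatMap⁻; ∈-allFin; ∈-lookup)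
open import Data.List.Properties using (length-++; ++-assoc; ++-identityʳ; length-reverse; reverse-involutive; partition-defn; filter-notAll; map-tabulate; length-map; length-tabulate)
open import Data.List.Relation.Binary.Disjoint.Propositional using (Disjoint)
open import Data.List.Relation.Binary.Permutation.Propositional using (_↭_; ↭-sym)
import Data.List.Relation.Binary.Permutation.Propositional as Perm
open import Data.List.Relation.Binary.Permutation.Propositional.Properties using (∈-resp-↭; ↭-length; ↭-reverse; shift; All-resp-↭)
import Data.List.Relation.Binary.Permutation.Setoid.Properties as PermSetoid
import Data.List.Relation.Binary.Sublist.Propositional as Sublist
import Data.List.Relation.Binary.Sublist.Propositional.Properties as Sublist
open import Data.List.Relation.Binary.Subset.Propositional using (_⊆_)
open import Data.List.Relation.Unary.All using (All; []; _∷_)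
import Data.List.Relation.Unary.All as All
import Data.List.Relation.Unary.All.Properties as All
open import Data.List.Relation.Unary.AllPairs using (AllPairs; []; _∷_)
import Data.List.Relation.Unary.AllPairs.Properties as AllPairs
open import Data.List.Relation.Unary.Any using (Any; here; there)
import Data.List.Relation.Unary.Any as Any
import Data.List.Relation.Unary.Any.Properties as Any
import Data.List.Relation.Unary.Unique.DecPropositional as DecUnique
open import Data.List.Relation.Unary.Unique.Propositional using (Unique)
import Data.List.Relation.Unary.Unique.Propositional.Properties as Unique
open import Data.Nat using (ℕ; zero; suc; _+_; _*_; _≤_; _<_; z≤n; s≤s)
import Data.Nat as ℕ
import Data.Nat.Coprimality as Coprime
import Data.Nat.DivMod as ℕ
import Data.Nat.Divisibility as ℕ
import Data.Nat.GCD as GCD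
open import Data.Nat.ListAction using (sum)
open import Data.Nat.Primality using (Prime; prime⇒nonZero; ¬prime[1])
open import Data.Nat.Properties using (module ≤-Reasoning; ≤-refl; ≤-trans; ≤-reflexive; ≤-pred; +-suc; +-monoˡ-≤; +-monoʳ-≤; +-mono-≤; <-irrefl; suc-injective; m≤n+m)
import Data.Nat.Properties as ℕ
open import Data.Nat.Tactic.RingSolver using (solve-∀)
open import Data.Product using (Σ; ∃; _×_; _,_; proj₁; proj₂)
open import Data.Sum using (_⊎_; inj₁; inj₂; [_,_]′)
open import Data.Unit using (⊤; tt)
open import Function using (_∘_; id; case_of_)
open import Relation.Binary.Definitions using (DecidableEquality)
open import Relation.Binary.PropositionalEquality using (_≡_; refl; sym; trans; cong; cong₂; subst; setoid; _≢_; module ≡-Reasoning)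
open import Relation.Nullary using (¬_; Dec; yes; no; contradiction; ¬?; _×-dec_)
open import Relation.Nullary.Decidable using (map′; decidable-stable)
open import Relation.Unary using (Decidable)
open import Relation.Unary.Properties using (∁?)

allPairs-resp-⊆ : ∀ {A : Set} {R : A → A → Set} {xs ys} → xs Sublist.⊆ ys → AllPairs R ys → AllPairs R xs
allPairs-resp-⊆ Sublist.[]            []       = []
allPairs-resp-⊆ (_ Sublist.∷ʳ τ)      (_ ∷ ps) = allPairs-resp-⊆ τ ps
allPairs-resp-⊆ (refl Sublist.∷ τ)    (p ∷ ps) = Sublist.All-resp-⊆ τ p ∷ allPairs-resp-⊆ τ ps

-- Matroids

-- A matroid given by its closure operator on finite lists; the ground set may be infinite, as for
-- the integer vectors below. Decidable closure makes the exchange arguments constructive.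
record Matroid (E : Set) : Set₁ where
  field
    Cl          : List E → E → Set
    cl?         : ∀ L → Decidable (Cl L)
    cl-∈        : ∀ {L x} → x ∈ L → Cl L x
    cl-trans    : ∀ {L L' x} → (∀ {y} → y ∈ L → Cl L' y) → Cl L x → Cl L' x
    cl-exchange : ∀ {L x y} → Cl (y ∷ L) x → ¬ Cl L x → Cl (x ∷ L) y

module MatroidProperties {E : Set} (M : Matroid E) where
  open Matroid M public

  cl-mono : ∀ {L L' x} → L ⊆ L' → Cl L x → Cl L' x
  cl-mono L⊆L' = cl-trans (cl-∈ ∘ L⊆L')

  cl-there : ∀ {L x y} → Cl L x → Cl (y ∷ L) x
  cl-there = cl-mono there

  cl-++ʳ : ∀ B {L x} → Cl L x → Cl (B ++ L) x
  cl-++ʳ B = cl-mono (∈-++⁺ʳ B)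

  infix 4 _⊑_
  _⊑_ : List E → List E → Set
  L ⊑ L' = ∀ {x} → Cl L x → Cl L' x

  ⊑-∷ : ∀ {L L' e} → L ⊑ L' → e ∷ L ⊑ e ∷ L'
  ⊑-∷ L⊑L' = cl-trans λ where
    (here refl) → cl-∈ (here refl)
    (there y∈L) → cl-there (L⊑L' (cl-∈ y∈L))

  ⊑-++ : ∀ B {L L'} → L ⊑ L' → B ++ L ⊑ B ++ L'
  ⊑-++ []      L⊑L' = L⊑L'
  ⊑-++ (e ∷ B) L⊑L' = ⊑-∷ (⊑-++ B L⊑L')

  -- Only the later entries are tested, which suits recursion; `indep-↭` shows that the order does
  -- not matter.
  Indep : List E → Set
  Indep []      = ⊤
  Indep (x ∷ L) = ¬ Cl L x × Indep L

  indep-++⁻ʳ : ∀ B {L} → Indep (B ++ L) → Indep L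
  indep-++⁻ʳ []      ind       = ind
  indep-++⁻ʳ (_ ∷ B) (_ , ind) = indep-++⁻ʳ B ind

  indep-ʳ++⁻ʳ : ∀ B {L} → Indep (B ʳ++ L) → Indep L
  indep-ʳ++⁻ʳ []      ind = ind
  indep-ʳ++⁻ʳ (_ ∷ B) ind = proj₂ (indep-ʳ++⁻ʳ B ind)

  -- The closures that the entries of `B` must stay out of can only shrink when `L'` takes the place
  -- of `L`. Thus a recursive call may change the list below an untouched `B`.
  indep-++-⊑ : ∀ B {L L'} → L' ⊑ L → Indep L' → Indep (B ++ L) → Indep (B ++ L')
  indep-++-⊑ []      _    ind' _          = ind'
  indep-++-⊑ (_ ∷ B) L'⊑L ind' (e∉ , ind) = e∉ ∘ ⊑-++ B L'⊑L , indep-++-⊑ B L'⊑L ind' ind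

  -- For a swap, `y` in the closure of `x ∷ L` but not of `L` would by exchange put `x` into the
  -- closure of `y ∷ L`.
  indep-↭ : ∀ {L L'} → L ↭ L' → Indep L → Indep L'
  indep-↭ Perm.refl           ind        = ind
  indep-↭ (Perm.prep x σ)     (x∉ , ind) = x∉ ∘ cl-mono (∈-resp-↭ (↭-sym σ)) , indep-↭ σ ind
  indep-↭ (Perm.swap x y σ)   (x∉ , y∉ , ind) =
    (λ y∈ → x∉ (cl-exchange (cl-mono (there′ (∈-resp-↭ (↭-sym σ))) y∈) y∉)) ,
    x∉ ∘ cl-there ∘ cl-mono (∈-resp-↭ (↭-sym σ)) ,
    indep-↭ σ ind
    where
    there′ : ∀ {L L' : List E} {z} → L ⊆ L' → z ∷ L ⊆ z ∷ L'
    there′ s (here refl) = here refl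
    there′ s (there i)   = there (s i)
  indep-↭ (Perm.trans σ τ)    ind        = indep-↭ τ (indep-↭ σ ind)

  ∉-++-∷ : ∀ B {L x} → ¬ Cl (B ++ L) x → Indep (B ++ L) → Indep (B ++ x ∷ L)
  ∉-++-∷ B x∉ ind = indep-↭ (↭-sym (shift _ B _)) (x∉ , ind)

  record Exchange (B K : List E) (x : E) : Set where
    constructor exchanged
    field
      rest     : List E
      rest⊆    : rest Sublist.⊆ B
      size     : length B ≡ suc (length rest)
      indep    : Indep (rest ++ x ∷ K)
      closure  : rest ++ x ∷ K ⊑ B ++ K

  -- The entry to give up lies on the circuit that `x` closes: it is where the suffixes of `B`, over
  -- `K`, stop spanning `x`. As `K` alone does not span `x`, there is such an entry.
  exchange : ∀ B {K x} → Indep (B ++ K) → Cl (B ++ K) x → ¬ Cl K x → Exchange B K x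
  exchange []      _          x∈ x∉ = contradiction x∈ x∉
  exchange (e ∷ B) {K} {x} (e∉ , ind) x∈ x∉ with cl? (B ++ K) x
  ... | no x∉B = exchanged B (e Sublist.∷ʳ Sublist.⊆-refl) refl (∉-++-∷ B x∉B ind) (cl-trans λ y∈ →
          case ∈-++⁻ B y∈ of λ where
            (inj₁ y∈B)          → cl-∈ (there (∈-++⁺ˡ y∈B))
            (inj₂ (here refl))  → x∈
            (inj₂ (there y∈K))  → cl-∈ (there (∈-++⁺ʳ B y∈K)))
  ... | yes x∈B with exchange B ind x∈B x∉
  ...   | exchanged B⁻ sub sz ind⁻ clo =
          exchanged (e ∷ B⁻) (refl Sublist.∷ sub)
            (cong suc sz) (e∉ ∘ clo , ind⁻) (⊑-∷ clo)

  -- The same scan as in `exchange`, with the inclusion of closures that Steinitz needs: the dropped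
  -- entry is regained from `y` by `cl-exchange`.
  replace : ∀ B {K y} → Cl (B ++ K) y → ¬ Cl K y →
            ∃ λ B⁻ → length B ≡ suc (length B⁻) × B ++ K ⊑ B⁻ ++ y ∷ K
  replace []      y∈ y∉ = contradiction y∈ y∉
  replace (e ∷ B) {K} {y} y∈ y∉ with cl? (B ++ K) y
  ... | yes y∈B with replace B y∈B y∉
  ...   | B⁻ , sz , sub = e ∷ B⁻ , cong suc sz , ⊑-∷ sub
  replace (e ∷ B) {K} {y} y∈ y∉ | no y∉B = B , refl , cl-trans λ
    { (here refl)  → cl-mono y∷B++K⊆ (cl-exchange y∈ y∉B)
    ; (there z∈)   → cl-mono (y∷B++K⊆ ∘ there) (cl-∈ z∈) }
    where
    y∷B++K⊆ : y ∷ B ++ K ⊆ B ++ y ∷ K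
    y∷B++K⊆ (here refl) = ∈-++⁺ʳ B (here refl)
    y∷B++K⊆ (there z∈)  = [ ∈-++⁺ˡ , ∈-++⁺ʳ B ∘ there ]′ (∈-++⁻ B z∈)

  -- The entries of `L` pass one by one into `K`, each driving an entry out of `B`. With `ʳ++` the
  -- independent list remains the same throughout, by computation.
  steinitz-over : ∀ L {B K} → Indep (L ʳ++ K) → All (Cl (B ++ K)) L → length L ≤ length B
  steinitz-over []      _   _        = z≤n
  steinitz-over (y ∷ L) {B} ind (y∈ ∷ L⊑)
    with B⁻ , sz , sub ← replace B y∈ (proj₁ (indep-ʳ++⁻ʳ L ind))
    = ≤-trans (s≤s (steinitz-over L {B⁻} ind (All.map sub L⊑))) (≤-reflexive (sym sz))

  steinitz : ∀ {L B} → Indep L → All (Cl B) L → length L ≤ length B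
  steinitz {L} {B} ind L⊑B = subst (_≤ length B) (length-reverse L)
    (steinitz-over (reverse L) (subst Indep (sym (reverse-involutive L)) ind)
      (All-resp-↭ (↭-sym (↭-reverse L)) (All.map (cl-mono (subst (_ ∈_) (sym (++-identityʳ B)))) L⊑B)))

  -- A further `x` would extend `L` to an independent list longer than `B`, against `steinitz`.
  saturated : ∀ {L B} → Indep L → All (Cl B) L → length B ≤ length L → B ⊑ L
  saturated {L} ind L⊑B B≤L {x} x∈ with cl? L x
  ... | yes x∈L = x∈L
  ... | no  x∉L = contradiction (≤-trans (steinitz (x∉L , ind) (x∈ ∷ L⊑B)) B≤L) (<-irrefl refl)

-- Independent packings of hyperedges

module Packing
  {E V : Set} (M : Matroid E) (_≟_ : DecidableEquality V)
  (Valid : E → Set) (verts : E → List V) (verts-length : ∀ e → length (verts e) ≡ 3)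
  where
  open MatroidProperties M
  open import Data.List.Membership.DecPropositional _≟_ using (_∈?_; _∉?_)

  Avoids : List V → E → Set
  Avoids F e = Valid e × Disjoint (verts e) F

  Apart : E → E → Set
  Apart e f = Disjoint (verts e) (verts f)

  record Packed (F : List V) (K : List E) : Set where
    constructor packed
    field
      avoids : All (Avoids F) K
      apart  : AllPairs Apart K
  open Packed public

  flip-apart : ∀ {e f} → Apart e f → Apart f e
  flip-apart dis (i , j) = dis (j , i)

  Meets : E → E → Set
  Meets v e = Any (_∈ verts v) (verts e)

  meets? : ∀ v → Decidable (Meets v)
  meets? v e = Any.any? (_∈? verts v) (verts e)

  ¬meets⇒apart : ∀ {v e} → ¬ Meets v e → Apart v e
  ¬meets⇒apart ¬m (i , j) = ¬m (Any.map (λ { refl → i }) j)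

  -- `stuck` is a dual certificate: once `F'` is deleted, the edges of `K'` span all that is left,
  -- and the price of 5 per edge pays for the deleted vertices. In `found`, the condition `K' ⊑ K`
  -- keeps independent over `K'` what was independent over `K`.
  data Outcome (F : List V) (K : List E) : Set where
    stuck : ∀ F' K' → length F' + 5 * length K' ≤ length F + 5 * length K →
            length K' ≤ length K → Indep K' → (∀ e → Avoids F' e → Cl K' e) → Outcome F K
    found : ∀ K' x → length K' ≡ length K → Packed F (x ∷ K') → Indep (x ∷ K') →
            K' ⊑ K → Outcome F K

  outcome-resp : ∀ {F K K₁} → length K₁ ≡ length K → K₁ ⊑ K → Outcome F K₁ → Outcome F K
  outcome-resp {F} eq sub (stuck F' K' le le' ind all) =
    stuck F' K' (subst (λ m → _ ≤ length F + 5 * m) eq le) (subst (_ ≤_) eq le') ind all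
  outcome-resp eq sub (found K' x eq' pk ind sub') = found K' x (trans eq' eq) pk ind (sub ∘ sub')

  outer : E → E → List V
  outer v e = filter (_∉? verts v) (verts e)

  -- The vertices of e that also belong to v are already listed in verts v;
  -- not counting them twice is what makes the constant 5.
  forbid : E → List E → List V → List V
  forbid v B F = verts v ++ concatMap (outer v) B ++ F

  length-outer : ∀ {v e} → Meets v e → length (outer v e) ≤ 2
  length-outer {v} {e} m = ≤-pred (subst (length (outer v e) <_) (verts-length e)
    (filter-notAll (_∉? verts v) (verts e) (Any.map (λ i n → n i) m)))

  length-outers : ∀ {v B} → All (Meets v) B → length (concatMap (outer v) B) ≤ 2 * length B
  length-outers []                   = z≤n
  length-outers {v} {e ∷ B} (m ∷ ms) = begin
    length (outer v e ++ concatMap (outer v) B)           ≡⟨ length-++ (outer v e) ⟩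
    length (outer v e) + length (concatMap (outer v) B)   ≤⟨ +-mono-≤ (length-outer {v} {e} m) (length-outers ms) ⟩
    2 + 2 * length B                                      ≡⟨ lem (length B) ⟩
    2 * suc (length B)                                    ∎
    where
    open ≤-Reasoning
    lem : ∀ b → 2 + 2 * b ≡ 2 * suc b
    lem = solve-∀

  -- Three vertices of `v` and at most two more from each of k blocking edges: 3 + 2k is at most 5k
  -- as soon as k is positive, hence the separate `e`.
  length-forbid : ∀ v e B F → All (Meets v) (e ∷ B) →
                  length (forbid v (e ∷ B) F) ≤ length F + 5 * length (e ∷ B)
  length-forbid v e B F ms = begin
    length (verts v ++ C ++ F)               ≡⟨ trans (length-++ (verts v)) (cong₂ _+_ (verts-length v) (length-++ C)) ⟩
    3 + (length C + length F)                ≤⟨ +-monoʳ-≤ 3 (+-monoˡ-≤ (length F) (length-outers ms)) ⟩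
    3 + (2 * suc (length B) + length F)      ≤⟨ m≤n+m _ (3 * length B) ⟩
    3 * length B + (3 + (2 * suc (length B) + length F)) ≡⟨ lem (length B) (length F) ⟩
    length F + 5 * suc (length B)            ∎
    where
    open ≤-Reasoning
    C = concatMap (outer v) (e ∷ B)
    lem : ∀ b f → 3 * b + (3 + (2 * suc b + f)) ≡ f + 5 * suc b
    lem = solve-∀

  ∈-forbid-new : ∀ v B F {x} → x ∈ verts v → x ∈ forbid v B F
  ∈-forbid-new v B F = ∈-++⁺ˡ

  ∈-forbid-old : ∀ v B F {x} → x ∈ F → x ∈ forbid v B F
  ∈-forbid-old v B F i = ∈-++⁺ʳ (verts v) (∈-++⁺ʳ (concatMap (outer v) B) i)

  ∈-forbid-met : ∀ v B F {e x} → e ∈ B → x ∈ verts e → x ∈ forbid v B F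
  ∈-forbid-met v (e ∷ B) F {x = x} e∈ i with x ∈? verts v
  ... | yes j = ∈-++⁺ˡ j
  ∈-forbid-met v (e ∷ B) F {x = x} (here refl) i | no j =
    ∈-++⁺ʳ (verts v) (∈-++⁺ˡ (∈-++⁺ˡ (∈-filter⁺ (_∉? verts v) i j)))
  ∈-forbid-met v (e ∷ B) F {x = x} (there e∈) i | no j with ∈-++⁻ (verts v) (∈-forbid-met v B F e∈ i)
  ... | inj₁ k = contradiction k j
  ... | inj₂ k = ∈-++⁺ʳ (verts v) (subst (_ ∈_) (sym (++-assoc (outer v e) _ F)) (∈-++⁺ʳ (outer v e) k))

  avoids-forbid : ∀ v B F {e} → Avoids (forbid v B F) e → Avoids F e × Apart v e × All (λ f → Apart f e) B
  avoids-forbid v B F (ok , dis) =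
    (ok , λ (i , j) → dis (i , ∈-forbid-old v B F j)) ,
    (λ (i , j) → dis (j , ∈-forbid-new v B F i)) ,
    All.tabulate λ f∈ (i , j) → dis (j , ∈-forbid-met v B F f∈ i)

  packed-∷ : ∀ {F K x} → Avoids F x → All (Apart x) K → Packed F K → Packed F (x ∷ K)
  packed-∷ av ap (packed avs aps) = packed (av ∷ avs) (ap ∷ aps)

  packed-++ : ∀ {F B K} → Packed F B → Packed F K → All (λ b → All (Apart b) K) B → Packed F (B ++ K)
  packed-++ (packed av ap) (packed av' ap') cross = packed (All.++⁺ av av') (AllPairs.++⁺ ap ap' cross)

  packed-++⁻ : ∀ {F} B {K} → Packed F (B ++ K) → Packed F B × Packed F K × All (λ b → All (Apart b) K) B
  packed-++⁻ []      pk = packed [] [] , pk , []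
  packed-++⁻ (b ∷ B) (packed (av ∷ avs) (ap ∷ aps)) with packed-++⁻ B (packed avs aps)
  ... | pB , pK , cross = packed-∷ av (All.++⁻ˡ B ap) pB , pK , All.++⁻ʳ B ap ∷ cross

  packed-↭ : ∀ {F K K'} → K ↭ K' → Packed F K → Packed F K'
  packed-↭ σ (packed av ap) = packed (All-resp-↭ σ av)
    (PermSetoid.AllPairs-resp-↭ (setoid E) (λ {e} {f} → flip-apart {e} {f}) ((λ { refl → id }) , λ { refl → id })
      (Perm.↭⇒↭ₛ σ) ap)

  -- The sole access to the set of edges. The edge returned may meet members of `K`.
  Search : Set
  Search = ∀ F K → (∃ λ e → Avoids F e × ¬ Cl K e) ⊎ (∀ e → Avoids F e → Cl K e)

  module _ (search : Search) where

    SolveBelow : ℕ → Set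
    SolveBelow n = ∀ F K → length K < n → Packed F K → Indep K → Outcome F K

    -- A new edge found below either augments B ++ K₀ or can be exchanged for a
    -- member of B, so that fewer edges block v; m bounds the number of exchanges.
    unblock : ∀ {n} → SolveBelow n → ∀ m {F} v B K₀ → length B ≤ m → length B + length K₀ ≤ n →
              Avoids F v → All (Meets v) B → All (Apart v) K₀ →
              Packed F (B ++ K₀) → Indep (B ++ K₀) → ¬ Cl (B ++ K₀) v → Outcome F (B ++ K₀)
    unblock _ m v [] K₀ _ _ av _ ap pk ind v∉ = found K₀ v refl (packed-∷ av ap pk) (v∉ , ind) id
    unblock solve (suc m) {F} v B@(e ∷ B₀) K₀ (s≤s B≤m) BK≤n av ms ap pk ind v∉
      with packed-++⁻ B pk
    ... | pB , pK₀ , cross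
      -- Forbidding `v` and all of `B` makes new edges disjoint from them. `K₀` itself avoids the
      -- enlarged set, and it has fewer than `n` edges because `B` is not empty.
      with solve (forbid v B F) K₀ (≤-trans (s≤s (m≤n+m _ (length B₀))) BK≤n)
             (packed (All.zipWith avoids-F″ (All.tabulate id , All.zip (avoids pK₀ , ap))) (apart pK₀))
             (indep-++⁻ʳ B ind)
      where
      avoids-F″ : ∀ {k} → k ∈ K₀ × Avoids F k × Apart v k → Avoids (forbid v B F) k
      avoids-F″ {k} (k∈ , (ok , dis) , apv) = ok , λ (i , j) →
        [ (λ j → apv (j , i))
        , (λ j → [ (λ j → met j i)
                 , (λ j → dis (i , j)) ]′ (∈-++⁻ (concatMap (outer v) B) j)) ]′ (∈-++⁻ (verts v) j)
        where
        met : ∀ {x} → x ∈ concatMap (outer v) B → ¬ x ∈ verts k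
        met {x} j i with find (∈-concatMap⁻ (outer v) {xs = B} j)
        ... | f , f∈ , l = All.lookup (All.lookup cross f∈) k∈ (proj₁ (∈-filter⁻ (_∉? verts v) l) , i)
    -- The five units for each edge of `B` pay for the vertices added by `forbid`, so the same
    -- certificate serves here.
    ... | stuck F' K' le le' ind' all =
          stuck F' K' le₂ (≤-trans le' (≤-trans (m≤n+m _ (length B)) (≤-reflexive (sym (length-++ B))))) ind' all
      where
      open ≤-Reasoning
      lem : ∀ f b k → f + 5 * b + 5 * k ≡ f + 5 * (b + k)
      lem = solve-∀
      le₂ : length F' + 5 * length K' ≤ length F + 5 * length (B ++ K₀)
      le₂ = begin
        length F' + 5 * length K'                   ≤⟨ le ⟩
        length (forbid v B F) + 5 * length K₀       ≤⟨ +-monoˡ-≤ (5 * length K₀) (length-forbid v e B₀ F ms) ⟩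
        length F + 5 * length B + 5 * length K₀     ≡⟨ lem (length F) (length B) (length K₀) ⟩
        length F + 5 * (length B + length K₀)       ≡⟨ cong (λ l → length F + 5 * l) (sym (length-++ B)) ⟩
        length F + 5 * length (B ++ K₀)             ∎
    ... | found K' x eq (packed (avx ∷ avK') (apx ∷ apK')) (x∉ , indK') sub
      with avoids-forbid v B F avx | All.map (avoids-forbid v B F) avK'
    ... | avx' , apvx , apBx | avsK'
      -- `B` stays independent over `K'`, which spans no more than `K₀`. Hence `x` either enlarges
      -- the packing or closes a circuit through `B`.
      with cl? (B ++ K') x
    ... | no x∉B = found (B ++ K') x
            (trans (length-++ B) (trans (cong (λ k → length B + k) eq) (sym (length-++ B))))
            (packed-∷ avx' (All.++⁺ (All.map (λ {f} → flip-apart {f} {x}) apBx) apx)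
              (packed-++ pB (packed (All.map proj₁ avsK') apK')
                (All.tabulate λ b∈ → All.map (λ a → All.lookup (proj₂ (proj₂ a)) b∈) avsK')))
            (x∉B , indep-++-⊑ B sub indK' ind)
            (⊑-++ B sub)
    ... | yes x∈B with exchange B (indep-++-⊑ B sub indK' ind) x∈B x∉
    ... | exchanged B⁻ B⁻⊆B sz ind⁻ clo =
            outcome-resp {K₁ = B⁻ ++ x ∷ K'}
              (trans (length-++ B⁻) (trans total (sym (length-++ B))))
              (⊑-++ B sub ∘ clo)
              (unblock solve m v B⁻ (x ∷ K')
                (subst (_≤ m) (suc-injective sz) B≤m)
                (≤-trans (≤-reflexive total) BK≤n)
                av (Sublist.All-resp-⊆ B⁻⊆B ms) (apvx ∷ All.map (proj₁ ∘ proj₂) avsK')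
                (packed-++ (packed (Sublist.All-resp-⊆ B⁻⊆B (avoids pB)) (allPairs-resp-⊆ B⁻⊆B (apart pB)))
                  (packed (avx' ∷ All.map proj₁ avsK') (apx ∷ apK'))
                  (Sublist.All-resp-⊆ B⁻⊆B (All.tabulate λ b∈ → All.lookup apBx b∈ ∷
                    All.map (λ a → All.lookup (proj₂ (proj₂ a)) b∈) avsK')))
                ind⁻
                -- The span has not grown, so `v` is still outside it.
                (v∉ ∘ ⊑-++ B sub ∘ clo))
      where
      total : length B⁻ + suc (length K') ≡ length B + length K₀
      total = trans (+-suc (length B⁻) (length K')) (cong₂ _+_ (sym sz) eq)

    -- Without an unspanned edge `v`, the pair `F`, `K` is itself the certificate. Otherwise `K` is
    -- permuted so that its members meeting `v` come first.
    solve-step : ∀ {n} → SolveBelow n → ∀ F K → length K ≤ n → Packed F K → Indep K → Outcome F K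
    solve-step solve F K K≤n pk ind with search F K
    ... | inj₂ all              = stuck F K ≤-refl ≤-refl ind all
    ... | inj₁ (v , av , v∉)    = outcome-resp (sym (↭-length σ)) (cl-mono (∈-resp-↭ (↭-sym σ)))
      (unblock solve (length B) v B K₀ ≤-refl
        (≤-trans (≤-reflexive (trans (sym (length-++ B)) (sym (↭-length σ)))) K≤n)
        av (All.all-filter (meets? v) K) (All.map ¬meets⇒apart (All.all-filter (∁? (meets? v)) K))
        (packed-↭ σ pk) (indep-↭ σ ind) (v∉ ∘ cl-mono (∈-resp-↭ (↭-sym σ))))
      where
      B  = filter (meets? v) K
      K₀ = filter (∁? (meets? v)) K
      σ : K ↭ B ++ K₀
      σ = subst (λ (ys , zs) → K ↭ ys ++ zs) (partition-defn (meets? v) K)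
            (Perm.↭ₛ⇒↭ (PermSetoid.partition-↭ (setoid E) (meets? v) K))

    solve-below : ∀ n → SolveBelow n
    solve-below (suc n) F K (s≤s K≤n) = solve-step (solve-below n) F K K≤n

    solve : ∀ F K → Packed F K → Indep K → Outcome F K
    solve F K = solve-below (suc (length K)) F K ≤-refl

-- Linear algebra modulo p

∑-suc : ∀ m (f : Fin (suc m) → ℕ) → ∑ (suc m) f ≡ f zero + ∑ m (f ∘ suc)
∑-suc m f = cong (λ l → f zero + sum l) (trans (map-tabulate suc f) (sym (map-tabulate id (f ∘ suc))))

module Linear (p d : ℕ) (pr : Prime p) where

  private instance
    p≢0 : ℕ.NonZero p
    p≢0 = prime⇒nonZero pr

  infixl 6 _⊕_ _⊖_
  infixl 7 _⊙_
  infix  4 _≐_ _≋_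

  -- Integer coordinates stand for residues, with `≋` as equality modulo p; the identities needed
  -- are then identities in ℤ, open to the ring solver.
  V : Set
  V = Fin d → ℤ

  _⊕_ _⊖_ : V → V → V
  (x ⊕ y) j = x j ℤ.+ y j
  (x ⊖ y) j = x j ℤ.- y j

  _⊙_ : ℤ → V → V
  (a ⊙ x) j = a ℤ.* x j

  𝟎 : V
  𝟎 _ = 0ℤ

  _≐_ _≋_ : V → V → Set
  x ≐ y = ∀ j → x j ≡ y j
  x ≋ y = ∀ j → + p ∣ (x ⊖ y) j

  Span : List V → V → Set
  Span []      x = ∀ j → + p ∣ x j
  Span (y ∷ L) x = Σ ℤ λ a → Span L (x ⊖ a ⊙ y)

  span-≐ : ∀ L {x y} → x ≐ y → Span L x → Span L y
  span-≐ []      x≐y x∈       = λ j → subst (+ p ∣_) (x≐y j) (x∈ j)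
  span-≐ (v ∷ L) x≐y (a , x∈) = a , span-≐ L (λ j → cong (ℤ._- a ℤ.* v j) (x≐y j)) x∈

  span-comb : ∀ L a b {x y} → Span L x → Span L y → Span L (a ⊙ x ⊕ b ⊙ y)
  span-comb []      a b x∈ y∈ = λ j → ∣m∣n⇒∣m+n (∣n⇒∣m*n a (x∈ j)) (∣n⇒∣m*n b (y∈ j))
  span-comb (v ∷ L) a b {x} {y} (α , x∈) (β , y∈) =
    a ℤ.* α ℤ.+ b ℤ.* β ,
    span-≐ L (λ j → identity a b α β (x j) (y j) (v j)) (span-comb L a b x∈ y∈)
    where
    identity : ∀ a b α β x y v → a ℤ.* (x ℤ.- α ℤ.* v) ℤ.+ b ℤ.* (y ℤ.- β ℤ.* v)
                                 ≡ a ℤ.* x ℤ.+ b ℤ.* y ℤ.- (a ℤ.* α ℤ.+ b ℤ.* β) ℤ.* v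
    identity = ℤRing.solve-∀

  span-⊕ : ∀ L {x y} → Span L x → Span L y → Span L (x ⊕ y)
  span-⊕ L {x} {y} x∈ y∈ = span-≐ L (λ j → identity (x j) (y j)) (span-comb L 1ℤ 1ℤ x∈ y∈)
    where
    identity : ∀ x y → 1ℤ ℤ.* x ℤ.+ 1ℤ ℤ.* y ≡ x ℤ.+ y
    identity = ℤRing.solve-∀

  span-⊖ : ∀ L {x y} → Span L x → Span L y → Span L (x ⊖ y)
  span-⊖ L {x} {y} x∈ y∈ = span-≐ L (λ j → identity (x j) (y j)) (span-comb L 1ℤ (ℤ.- 1ℤ) x∈ y∈)
    where
    identity : ∀ x y → 1ℤ ℤ.* x ℤ.+ (ℤ.- 1ℤ) ℤ.* y ≡ x ℤ.- y
    identity = ℤRing.solve-∀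

  span-⊙ : ∀ L a {x} → Span L x → Span L (a ⊙ x)
  span-⊙ L a {x} x∈ = span-≐ L (λ j → identity a (x j)) (span-comb L a 0ℤ x∈ x∈)
    where
    identity : ∀ a x → a ℤ.* x ℤ.+ 0ℤ ℤ.* x ≡ a ℤ.* x
    identity = ℤRing.solve-∀

  span-there : ∀ L {x y} → Span L x → Span (y ∷ L) x
  span-there L {x} {y} x∈ = 0ℤ , span-≐ L (λ j → identity (x j) (y j)) x∈
    where
    identity : ∀ x y → x ≡ x ℤ.- 0ℤ ℤ.* y
    identity = ℤRing.solve-∀

  span-[] : ∀ L {x} → Span [] x → Span L x
  span-[] []      x∈ = x∈
  span-[] (_ ∷ L) x∈ = span-there L (span-[] L x∈)

  span-here : ∀ L {x} → Span (x ∷ L) x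
  span-here L {x} = 1ℤ , span-[] L λ j → divides 0ℤ (identity (x j) (+ p))
    where
    identity : ∀ x p → x ℤ.- 1ℤ ℤ.* x ≡ 0ℤ ℤ.* p
    identity = ℤRing.solve-∀

  span-∈ : ∀ {L x} → x ∈ L → Span L x
  span-∈ {x ∷ L} (here refl) = span-here L {x}
  span-∈ {_ ∷ L} (there x∈)  = span-there L (span-∈ x∈)

  ≐⇒≋ : ∀ {x y} → x ≐ y → x ≋ y
  ≐⇒≋ {x} {y} x≐y j = divides 0ℤ (trans (cong (ℤ._- y j) (x≐y j)) (ℤ.+-inverseʳ (y j)))

  ≋-sym : ∀ {x y} → x ≋ y → y ≋ x
  ≋-sym {x} {y} x≋y j = subst (+ p ∣_) (identity (x j) (y j)) (∣n⇒∣m*n (ℤ.- 1ℤ) (x≋y j))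
    where
    identity : ∀ x y → (ℤ.- 1ℤ) ℤ.* (x ℤ.- y) ≡ y ℤ.- x
    identity = ℤRing.solve-∀

  ≋-trans : ∀ {x y z} → x ≋ y → y ≋ z → x ≋ z
  ≋-trans {x} {y} {z} x≋y y≋z j = subst (+ p ∣_) (identity (x j) (y j) (z j)) (∣m∣n⇒∣m+n (x≋y j) (y≋z j))
    where
    identity : ∀ x y z → (x ℤ.- y) ℤ.+ (y ℤ.- z) ≡ x ℤ.- z
    identity = ℤRing.solve-∀

  ⊕-cong : ∀ {x x' y y'} → x ≋ x' → y ≋ y' → x ⊕ y ≋ x' ⊕ y'
  ⊕-cong {x} {x'} {y} {y'} e f j =
    subst (+ p ∣_) (identity (x j) (x' j) (y j) (y' j)) (∣m∣n⇒∣m+n (e j) (f j))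
    where
    identity : ∀ x x' y y' → (x ℤ.- x') ℤ.+ (y ℤ.- y') ≡ x ℤ.+ y ℤ.- (x' ℤ.+ y')
    identity = ℤRing.solve-∀

  ⊖-cong : ∀ {x x' y y'} → x ≋ x' → y ≋ y' → x ⊖ y ≋ x' ⊖ y'
  ⊖-cong {x} {x'} {y} {y'} e f j =
    subst (+ p ∣_) (identity (x j) (x' j) (y j) (y' j)) (∣m∣n⇒∣m-n (e j) (f j))
    where
    identity : ∀ x x' y y' → (x ℤ.- x') ℤ.- (y ℤ.- y') ≡ x ℤ.- y ℤ.- (x' ℤ.- y')
    identity = ℤRing.solve-∀

  ⊙-cong : ∀ a {x x'} → x ≋ x' → a ⊙ x ≋ a ⊙ x'
  ⊙-cong a {x} {x'} e j = subst (+ p ∣_) (identity a (x j) (x' j)) (∣n⇒∣m*n a (e j))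
    where
    identity : ∀ a x x' → a ℤ.* (x ℤ.- x') ≡ a ℤ.* x ℤ.- a ℤ.* x'
    identity = ℤRing.solve-∀

  span-≋ : ∀ L {x y} → x ≋ y → Span L x → Span L y
  span-≋ L {x} {y} x≋y x∈ = span-≐ L (λ j → identity (x j) (y j)) (span-⊖ L x∈ (span-[] L x≋y))
    where
    identity : ∀ x y → x ℤ.- (x ℤ.- y) ≡ y
    identity = ℤRing.solve-∀

  span-trans : ∀ L L' {x} → (∀ {y} → y ∈ L → Span L' y) → Span L x → Span L' x
  span-trans []      L' _    x∈       = span-[] L' x∈
  span-trans (y ∷ L) L' L⊑L' (a , x∈) =
    span-≐ L' (λ j → identity a _ (y j))
      (span-⊕ L' (span-trans L L' (L⊑L' ∘ there) x∈) (span-⊙ L' a (L⊑L' (here refl))))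
    where
    identity : ∀ a x y → x ℤ.- a ℤ.* y ℤ.+ a ℤ.* y ≡ x
    identity = ℤRing.solve-∀

  -- Bézout for p and the nonzero remainder of `a`; the last two cases are the two signs that it can
  -- take over the naturals.
  inverse : ∀ a → ¬ + p ∣ a → ∃ λ m → + p ∣ 1ℤ ℤ.- m ℤ.* a
  inverse a p∤a with a ℤ.%ℕ p in eq
  ... | zero  = contradiction (divides (a ℤ./ℕ p) (trans (ℤ.a≡a%ℕn+[a/ℕn]*n a p)
                  (trans (cong (λ r → + r ℤ.+ (a ℤ./ℕ p) ℤ.* + p) eq) (ℤ.+-identityˡ _)))) p∤a
  ... | suc r with Coprime.coprime-Bézout (Coprime.prime⇒coprime {n = suc r} pr (subst (_< p) eq (ℤ.n%ℕd<d a p)))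
  ...   | GCD.Bézout.+- x y e = ℤ.- + y , divides (+ x ℤ.+ + y ℤ.* q) (begin
      1ℤ ℤ.- (ℤ.- + y) ℤ.* a                    ≡⟨ cong (λ a → 1ℤ ℤ.- (ℤ.- + y) ℤ.* a) a≡ ⟩
      1ℤ ℤ.- (ℤ.- + y) ℤ.* (s ℤ.+ q ℤ.* + p)    ≡⟨ identity (+ y) s q (+ p) ⟩
      1ℤ ℤ.+ + y ℤ.* s ℤ.+ + y ℤ.* q ℤ.* + p    ≡⟨ cong (ℤ._+ + y ℤ.* q ℤ.* + p) e' ⟩
      + x ℤ.* + p ℤ.+ + y ℤ.* q ℤ.* + p         ≡⟨ sym (ℤ.*-distribʳ-+ (+ p) (+ x) (+ y ℤ.* q)) ⟩
      (+ x ℤ.+ + y ℤ.* q) ℤ.* + p               ∎)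
    where
    open ≡-Reasoning
    q = a ℤ./ℕ p
    s = + suc r
    a≡ : a ≡ s ℤ.+ q ℤ.* + p
    a≡ = trans (ℤ.a≡a%ℕn+[a/ℕn]*n a p) (cong (λ r → + r ℤ.+ q ℤ.* + p) eq)
    e' : 1ℤ ℤ.+ + y ℤ.* s ≡ + x ℤ.* + p
    e' = trans (cong (λ z → 1ℤ ℤ.+ z) (sym (ℤ.pos-* y (suc r)))) (trans (cong +_ e) (ℤ.pos-* x p))
    identity : ∀ y s q p → 1ℤ ℤ.- (ℤ.- y) ℤ.* (s ℤ.+ q ℤ.* p) ≡ 1ℤ ℤ.+ y ℤ.* s ℤ.+ y ℤ.* q ℤ.* p
    identity = ℤRing.solve-∀
  ...   | GCD.Bézout.-+ x y e = + y , divides (ℤ.- (+ x ℤ.+ + y ℤ.* q)) (begin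
      1ℤ ℤ.- + y ℤ.* a                                ≡⟨ cong (λ a → 1ℤ ℤ.- + y ℤ.* a) a≡ ⟩
      1ℤ ℤ.- + y ℤ.* (s ℤ.+ q ℤ.* + p)                ≡⟨ identity (+ y) s q (+ p) ⟩
      1ℤ ℤ.- + y ℤ.* s ℤ.- + y ℤ.* q ℤ.* + p          ≡⟨ cong (λ z → 1ℤ ℤ.- z ℤ.- + y ℤ.* q ℤ.* + p) e' ⟩
      1ℤ ℤ.- (1ℤ ℤ.+ + x ℤ.* + p) ℤ.- + y ℤ.* q ℤ.* + p ≡⟨ identity′ (+ x) (+ y) q (+ p) ⟩
      ℤ.- (+ x ℤ.+ + y ℤ.* q) ℤ.* + p                 ∎)
    where
    open ≡-Reasoning
    q = a ℤ./ℕ p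
    s = + suc r
    a≡ : a ≡ s ℤ.+ q ℤ.* + p
    a≡ = trans (ℤ.a≡a%ℕn+[a/ℕn]*n a p) (cong (λ r → + r ℤ.+ q ℤ.* + p) eq)
    e' : + y ℤ.* s ≡ 1ℤ ℤ.+ + x ℤ.* + p
    e' = trans (sym (ℤ.pos-* y (suc r))) (trans (cong +_ (sym e)) (cong (λ z → 1ℤ ℤ.+ z) (ℤ.pos-* x p)))
    identity : ∀ y s q p → 1ℤ ℤ.- y ℤ.* (s ℤ.+ q ℤ.* p) ≡ 1ℤ ℤ.- y ℤ.* s ℤ.- y ℤ.* q ℤ.* p
    identity = ℤRing.solve-∀
    identity′ : ∀ x y q p → 1ℤ ℤ.- (1ℤ ℤ.+ x ℤ.* p) ℤ.- y ℤ.* q ℤ.* p ≡ ℤ.- (x ℤ.+ y ℤ.* q) ℤ.* p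
    identity′ = ℤRing.solve-∀

  multiple-zero : ∀ {a} y → + p ∣ a → Span [] (a ⊙ y)
  multiple-zero y p∣a j = ∣m⇒∣m*n (y j) p∣a

  span-cancel : ∀ L {a y} → ¬ + p ∣ a → Span L (a ⊙ y) → Span L y
  span-cancel L {a} {y} p∤a ay∈ with m , p∣ ← inverse a p∤a =
    span-≐ L (λ j → identity m a (y j)) (span-⊕ L (span-⊙ L m ay∈) (span-[] L (multiple-zero y p∣)))
    where
    identity : ∀ m a y → m ℤ.* (a ℤ.* y) ℤ.+ (1ℤ ℤ.- m ℤ.* a) ℤ.* y ≡ y
    identity = ℤRing.solve-∀

  -- The coefficient of `y` in `x` is not divisible by p, as otherwise `x` would be in `Span L`; so
  -- it can be cancelled.
  span-exchange : ∀ L {x y} → Span (y ∷ L) x → ¬ Span L x → Span (x ∷ L) y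
  span-exchange L {x} {y} (a , x-ay∈) x∉ = span-cancel (x ∷ L) p∤a
    (1ℤ , span-≐ L (λ j → identity a (x j) (y j)) (span-⊙ L (ℤ.- 1ℤ) x-ay∈))
    where
    identity : ∀ a x y → (ℤ.- 1ℤ) ℤ.* (x ℤ.- a ℤ.* y) ≡ a ℤ.* y ℤ.- 1ℤ ℤ.* x
    identity = ℤRing.solve-∀
    identity′ : ∀ a x y → x ℤ.- a ℤ.* y ℤ.+ a ℤ.* y ≡ x
    identity′ = ℤRing.solve-∀
    p∤a : ¬ + p ∣ a
    p∤a p∣a = x∉ (span-≐ L (λ j → identity′ a (x j) (y j)) (span-⊕ L x-ay∈ (span-[] L (multiple-zero y p∣a))))

  residue : ℤ → Fin p
  residue a = fromℕ< (ℤ.n%ℕd<d a p)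

  residue-divides : ∀ a → + p ∣ a ℤ.- + toℕ (residue a)
  residue-divides a = divides (a ℤ./ℕ p) (begin
    a ℤ.- + toℕ (residue a)            ≡⟨ cong (λ r → a ℤ.- + r) (Fin.toℕ-fromℕ< (ℤ.n%ℕd<d a p)) ⟩
    a ℤ.- + r                          ≡⟨ cong (ℤ._- + r) (ℤ.a≡a%ℕn+[a/ℕn]*n a p) ⟩
    + r ℤ.+ (a ℤ./ℕ p) ℤ.* + p ℤ.- + r ≡⟨ identity (+ r) ((a ℤ./ℕ p) ℤ.* + p) ⟩
    (a ℤ./ℕ p) ℤ.* + p                 ∎)
    where
    open ≡-Reasoning
    r = a ℤ.%ℕ p
    identity : ∀ r q → r ℤ.+ q ℤ.- r ≡ q
    identity = ℤRing.solve-∀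

  span-residue : ∀ L {a x y} → Span L (x ⊖ a ⊙ y) → Span L (x ⊖ + toℕ (residue a) ⊙ y)
  span-residue L {a} {x} {y} x∈ =
    span-≐ L (λ j → identity a (+ toℕ (residue a)) (x j) (y j))
      (span-⊕ L x∈ (span-[] L (multiple-zero y (residue-divides a))))
    where
    identity : ∀ a r x y → x ℤ.- a ℤ.* y ℤ.+ (a ℤ.- r) ℤ.* y ≡ x ℤ.- r ℤ.* y
    identity = ℤRing.solve-∀

  -- Reducing a coefficient modulo p leaves only p candidates to try.
  span? : ∀ L x → Dec (Span L x)
  span? []      x = Fin.all? λ j → + p ∣? x j
  span? (y ∷ L) x = map′ (λ (c , x∈) → + toℕ c , x∈) (λ (a , x∈) → residue a , span-residue L {a} {x} {y} x∈)
                      (Fin.any? λ (c : Fin p) → span? L (x ⊖ + toℕ c ⊙ y))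

  spanMatroid : Matroid V
  spanMatroid = record
    { Cl          = Span
    ; cl?         = span?
    ; cl-∈        = span-∈
    ; cl-trans    = λ {L} {L'} → span-trans L L'
    ; cl-exchange = λ {L} → span-exchange L
    }

  module S = MatroidProperties spanMatroid

  unit : Fin d → V
  unit i j with i Fin.≟ j
  ... | yes _ = 1ℤ
  ... | no  _ = 0ℤ

  span-unit-coordinate : ∀ is {j x} → j ∉ is → Span (map unit is) x → + p ∣ x j
  span-unit-coordinate []       {j} _  x∈ = x∈ j
  span-unit-coordinate (i ∷ is) {j} {x} j∉ (a , x∈) with i Fin.≟ j | span-unit-coordinate is (j∉ ∘ there) x∈
  ... | yes refl | _ = contradiction (here refl) j∉
  ... | no _     | r = subst (+ p ∣_) (identity a (x j)) r
    where
    identity : ∀ a x → x ℤ.- a ℤ.* 0ℤ ≡ x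
    identity = ℤRing.solve-∀

  p∤1 : ¬ + p ∣ 1ℤ
  p∤1 p∣1 = ¬prime[1] (subst Prime (ℕ.∣1⇒≡1 (∣⇒∣ᵤ p∣1)) pr)

  unit-diagonal : ∀ i → unit i i ≡ 1ℤ
  unit-diagonal i with i Fin.≟ i
  ... | yes _ = refl
  ... | no ¬e = contradiction refl ¬e

  -- Coordinate `i` is divisible by p in every combination of the remaining units, but equals 1 in
  -- `unit i`.
  units-indep : ∀ {is} → Unique is → S.Indep (map unit is)
  units-indep {[]}     _         = tt
  units-indep {i ∷ is} (i∉ ∷ us) =
    (λ i∈ → p∤1 (subst (+ p ∣_) (unit-diagonal i) (span-unit-coordinate is (λ k → All.lookup i∉ k refl) i∈))) ,
    units-indep us

-- Bridge between the absolute difference in the definition of congruence and subtraction in ℤ.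
∣⊖∣ : ∀ m n → ℤ.∣ m ℤ.⊖ n ∣ ≡ ℕ.∣ m - n ∣
∣⊖∣ zero    zero    = refl
∣⊖∣ zero    (suc n) = refl
∣⊖∣ (suc m) zero    = refl
∣⊖∣ (suc m) (suc n) = trans (cong ℤ.∣_∣ (ℤ.[1+m]⊖[1+n]≡m⊖n m n)) (∣⊖∣ m n)

-- Bases and linear combinations modulo p

module Bases (p d : ℕ) (pr : Prime p) where
  open Linear p d pr

  private instance
    p≢0 : ℕ.NonZero p
    p≢0 = prime⇒nonZero pr

  ∣-⇒mod : ∀ {a b} → + p ∣ + a ℤ.- + b → a ≡ b [mod p ]
  ∣-⇒mod {a} {b} p∣ = subst (p ℕ.∣_) (trans (cong ℤ.∣_∣ (ℤ.[+m]-[+n]≡m⊖n a b)) (∣⊖∣ a b)) (∣⇒∣ᵤ p∣)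

  mod⇒∣- : ∀ {a b} → a ≡ b [mod p ] → + p ∣ + a ℤ.- + b
  mod⇒∣- {a} {b} p∣ = ∣ᵤ⇒∣ (subst (p ℕ.∣_) (sym (trans (cong ℤ.∣_∣ (ℤ.[+m]-[+n]≡m⊖n a b)) (∣⊖∣ a b))) p∣)

  units : List V
  units = map unit (allFin d)

  length-units : length units ≡ d
  length-units = trans (length-map unit (allFin d)) (length-tabulate id)

  span-units-supported : ∀ is x → (∀ j → j ∉ is → + p ∣ x j) → Span (map unit is) x
  span-units-supported []       x supp = λ j → supp j λ ()
  span-units-supported (i ∷ is) x supp = x i , span-units-supported is _ supp′
    where
    identity : ∀ x p → x ℤ.- x ℤ.* 1ℤ ≡ 0ℤ ℤ.* p
    identity = ℤRing.solve-∀
    identity′ : ∀ a x → x ≡ x ℤ.- a ℤ.* 0ℤ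
    identity′ = ℤRing.solve-∀
    supp′ : ∀ j → j ∉ is → + p ∣ (x ⊖ x i ⊙ unit i) j
    supp′ j j∉ with i Fin.≟ j
    ... | yes refl = divides 0ℤ (identity (x i) (+ p))
    ... | no  i≢j  = subst (+ p ∣_) (identity′ (x i) (x j))
                       (supp j λ { (here j≡i) → i≢j (sym j≡i) ; (there j∈) → j∉ j∈ })

  span-units : ∀ x → Span units x
  span-units x = span-units-supported (allFin d) x λ j j∉ → contradiction (∈-allFin j) j∉

  indep-length : ∀ {L} → S.Indep L → length L ≤ d
  indep-length {L} ind = subst (length L ≤_) length-units (S.steinitz ind (All.tabulate λ {x} _ → span-units x))

  full-spans : ∀ {L} → S.Indep L → length L ≡ d → ∀ x → Span L x
  full-spans {L} ind eq x = S.saturated ind (All.tabulate λ {x} _ → span-units x)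
    (ℕ.≤-reflexive (trans length-units (sym eq))) (span-units x)

  -- Greedy: an element of `U` is added only if what has been collected does not span it.
  extend : ∀ U L → S.Indep L → ∃ λ C → S.Indep (C ++ L) × All (Span (C ++ L)) U
  extend []      L ind = [] , ind , []
  extend (u ∷ U) L ind with extend U L ind
  ... | C , indC , allU with span? (C ++ L) u
  ...   | yes u∈ = C , indC , u∈ ∷ allU
  ...   | no  u∉ = u ∷ C , (u∉ , indC) , span-here (C ++ L) {u} ∷ All.map (span-there (C ++ L)) allU

  -- Steinitz against the d unit vectors, in both directions, gives the length.
  extend-basis : ∀ L → S.Indep L → ∃ λ C → S.Indep (C ++ L) × length (C ++ L) ≡ d
  extend-basis L ind with extend units L ind
  ... | C , indC , allU = C , indC , ℕ.≤-antisym (indep-length indC)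
        (subst (_≤ length (C ++ L)) length-units (S.steinitz (units-indep (Unique.allFin⁺ d)) allU))

  -- Were the coefficient of `c` nonzero modulo p, then `c` would be a combination of `C` and `b`.
  -- So all coefficients along `C` vanish.
  independent-intersection : ∀ C {b y} → S.Indep (C ++ b) → Span C y → Span b y → Span [] y
  independent-intersection []      _          y∈C _   = y∈C
  independent-intersection (c ∷ C) {b} {y} (c∉ , ind) (a , y∈C) y∈b with + p ∣? a
  ... | yes p∣a = independent-intersection C ind
        (span-≐ C (λ j → identity a (y j) (c j)) (span-⊕ C y∈C (span-[] C (multiple-zero c p∣a)))) y∈b
    where
    identity : ∀ a y c → y ℤ.- a ℤ.* c ℤ.+ a ℤ.* c ≡ y
    identity = ℤRing.solve-∀
  ... | no  p∤a = contradiction (span-cancel (C ++ b) p∤a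
        (span-≐ (C ++ b) (λ j → identity a (y j) (c j))
          (span-⊖ (C ++ b) (S.cl-++ʳ C y∈b) (S.cl-mono (∈-++⁺ˡ {xs = C}) y∈C)))) c∉
    where
    identity : ∀ a y c → y ℤ.- (y ℤ.- a ℤ.* c) ≡ a ℤ.* c
    identity = ℤRing.solve-∀

  embed : Vec𝔽 p d → V
  embed x j = + toℕ (x j)

  reduce : V → Vec𝔽 p d
  reduce x j = residue (x j)

  embed-reduce : ∀ x → embed (reduce x) ≋ x
  embed-reduce x = ≋-sym {x} λ j → residue-divides (x j)

  -- The length equation lets a list be indexed by `Fin d`, while proofs match it with `refl` and
  -- recurse on the list.
  family : ∀ {m} (L : List V) → length L ≡ m → Fin m → Vec𝔽 p d
  family (y ∷ L) refl zero    = reduce y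
  family (y ∷ L) refl (suc i) = family L refl i

  comb : (L : List V) → (Fin (length L) → ℤ) → V
  comb []      _ = 𝟎
  comb (y ∷ L) c = c zero ⊙ y ⊕ comb L (c ∘ suc)

  span-𝟎 : ∀ L → Span L 𝟎
  span-𝟎 L = span-[] L λ j → divides 0ℤ refl

  comb∈span : ∀ L c → Span L (comb L c)
  comb∈span []      c = λ j → divides 0ℤ refl
  comb∈span (y ∷ L) c = span-⊕ (y ∷ L) {c zero ⊙ y} {comb L (c ∘ suc)}
    (span-⊙ (y ∷ L) (c zero) {y} (span-here L {y})) (span-there L (comb∈span L (c ∘ suc)))

  lincomb≋comb : ∀ L (c : Fin (length L) → Fin p) →
                 (λ j → + lincomb c (family L refl) j) ≋ comb L (λ i → + toℕ (c i))
  lincomb≋comb []      c = ≐⇒≋ {𝟎} λ j → refl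
  lincomb≋comb (y ∷ L) c = ≋-trans {total} {a ⊙ embed (reduce y) ⊕ tail} {comb (y ∷ L) (λ i → + toℕ (c i))}
    (≐⇒≋ {total} λ j → trans (cong +_ (∑-suc (length L) (term j)))
      (cong (ℤ._+ tail j) (ℤ.pos-* (toℕ (c zero)) (toℕ (reduce y j)))))
    (⊕-cong {a ⊙ embed (reduce y)} {a ⊙ y} {tail} (⊙-cong a {embed (reduce y)} {y} (embed-reduce y)) (lincomb≋comb L (c ∘ suc)))
    where
    a = + toℕ (c zero)
    term : Fin d → Fin (length (y ∷ L)) → ℕ
    term j i = toℕ (c i) * toℕ (family (y ∷ L) refl i j)
    total tail : V
    total j = + lincomb c (family (y ∷ L) refl) j
    tail j  = + lincomb (c ∘ suc) (family L refl) j

  comb-zero : ∀ L → S.Indep L → ∀ c → Span [] (comb L c) → ∀ i → + p ∣ c i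
  comb-zero (y ∷ L) (y∉ , ind) c z i with + p ∣? c zero
  ... | no p∤c = contradiction (span-cancel L p∤c
        (span-≐ L (λ j → identity _ _) (span-⊖ L (span-[] L z) (comb∈span L (c ∘ suc))))) y∉
    where
    identity : ∀ x y → x ℤ.+ y ℤ.- y ≡ x
    identity = ℤRing.solve-∀
  comb-zero (y ∷ L) (y∉ , ind) c z zero    | yes p∣c = p∣c
  comb-zero (y ∷ L) (y∉ , ind) c z (suc i) | yes p∣c = comb-zero L ind (c ∘ suc)
    (λ j → ∣m+n∣m⇒∣n (z j) (multiple-zero y p∣c j)) i

  span⇒comb : ∀ L x → Span L x → ∃ λ (c : Fin (length L) → Fin p) → comb L (λ i → + toℕ (c i)) ≋ x
  span⇒comb []      x x∈ = (λ ()) , ≋-sym {x} {𝟎} λ j → subst (+ p ∣_) (sym (ℤ.+-identityʳ (x j))) (x∈ j)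
  span⇒comb (y ∷ L) x (a , x∈) with span⇒comb L _ x∈
  ... | c , e = c′ , ≋-trans {comb (y ∷ L) (λ i → + toℕ (c′ i))} {a ⊙ y ⊕ (x ⊖ a ⊙ y)} {x}
        (⊕-cong {+ toℕ (residue a) ⊙ y} {a ⊙ y} {comb L (λ i → + toℕ (c i))} {x ⊖ a ⊙ y} r≋ e)
        (≐⇒≋ {a ⊙ y ⊕ (x ⊖ a ⊙ y)} λ j → identity a (x j) (y j))
    where
    c′ : Fin (length (y ∷ L)) → Fin p
    c′ zero    = residue a
    c′ (suc i) = c i
    identity : ∀ a x y → a ℤ.* y ℤ.+ (x ℤ.- a ℤ.* y) ≡ x
    identity = ℤRing.solve-∀
    identity′ : ∀ a r y → (a ℤ.- r) ℤ.* y ≡ a ℤ.* y ℤ.- r ℤ.* y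
    identity′ = ℤRing.solve-∀
    r≋ : + toℕ (residue a) ⊙ y ≋ a ⊙ y
    r≋ = ≋-sym {a ⊙ y} λ j → subst (+ p ∣_) (identity′ a _ (y j)) (multiple-zero y (residue-divides a) j)

  family-independent : ∀ {m} L (eq : length L ≡ m) → S.Indep L → LinIndependent p d m (family L eq)
  family-independent L refl ind c z i with toℕ (c i) in e
  ... | zero  = refl
  ... | suc k = contradiction (ℕ.∣⇒≤ (subst (p ℕ.∣_) e (∣⇒∣ᵤ (comb-zero L ind _ comb≋0 i))))
                  (ℕ.<⇒≱ (subst (_< p) e (Fin.toℕ<n (c i))))
    where
    comb≋0 : Span [] (comb L λ i → + toℕ (c i))
    comb≋0 = span-≋ [] {λ j → + lincomb c (family L refl) j} (lincomb≋comb L c) λ j →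
      subst (+ p ∣_) (ℤ.+-identityʳ _) (mod⇒∣- {lincomb c (family L refl) j} {0} (z j))

  family-spanning : ∀ {m} L (eq : length L ≡ m) → (∀ x → Span L x) → Spanning p d m (family L eq)
  family-spanning L refl spans x with span⇒comb L (embed x) (spans (embed x))
  ... | c , e = c , λ j → ∣-⇒mod {lincomb c (family L refl) j}
        (≋-trans {λ j → + lincomb c (family L refl) j} {comb L (λ i → + toℕ (c i))} {embed x} (lincomb≋comb L c) e j)

  -- Subset sums

  SubsetSum : List V → V → Set
  SubsetSum []      x = Span [] x
  SubsetSum (y ∷ L) x = SubsetSum L x ⊎ SubsetSum L (x ⊖ y)

  subsetSum-≋ : ∀ L {x y} → x ≋ y → SubsetSum L x → SubsetSum L y
  subsetSum-≋ []      e s        = span-≋ [] e s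
  subsetSum-≋ (v ∷ L) e (inj₁ s) = inj₁ (subsetSum-≋ L e s)
  subsetSum-≋ (v ∷ L) {x} {y} e (inj₂ s) = inj₂ (subsetSum-≋ L (⊖-cong {x} {y} {v} e (≐⇒≋ {v} λ j → refl)) s)

  subsetSum⇒span : ∀ {L b x} → All (Span b) L → SubsetSum L x → Span b x
  subsetSum⇒span {[]}    {b} _         s        = span-[] b s
  subsetSum⇒span {v ∷ L} {b} (v∈ ∷ L⊑) (inj₁ s) = subsetSum⇒span L⊑ s
  subsetSum⇒span {v ∷ L} {b} {x} (v∈ ∷ L⊑) (inj₂ s) =
    span-≐ b (λ j → identity (x j) (v j)) (span-⊕ b (subsetSum⇒span L⊑ s) v∈)
    where
    identity : ∀ x v → x ℤ.- v ℤ.+ v ≡ x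
    identity = ℤRing.solve-∀

  subsetSum-++ : ∀ C {K x} → SubsetSum (C ++ K) x → ∃ λ y → SubsetSum C y × SubsetSum K (x ⊖ y)
  subsetSum-++ []      {K} {x} s = 𝟎 , span-𝟎 [] , subsetSum-≋ K (≐⇒≋ λ j → sym (ℤ.+-identityʳ (x j))) s
  subsetSum-++ (c ∷ C) (inj₁ s) with subsetSum-++ C s
  ... | y , sC , sK = y , inj₁ sC , sK
  subsetSum-++ (c ∷ C) {K} {x} (inj₂ s) with subsetSum-++ C s
  ... | y , sC , sK = y ⊕ c ,
        inj₂ (subsetSum-≋ C {y} (≐⇒≋ {y} λ j → identity (y j) (c j)) sC) ,
        subsetSum-≋ K {x ⊖ c ⊖ y} (≐⇒≋ {x ⊖ c ⊖ y} λ j → identity′ (x j) (y j) (c j)) sK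
    where
    identity : ∀ y c → y ≡ y ℤ.+ c ℤ.- c
    identity = ℤRing.solve-∀
    identity′ : ∀ x y c → x ℤ.- c ℤ.- y ≡ x ℤ.- (y ℤ.+ c)
    identity′ = ℤRing.solve-∀

  selectionSum : ∀ {m} → (Fin m → Bool) → (Fin m → Vec𝔽 p d) → V
  selectionSum {m} s b j = + ∑ m (λ i → if s i then toℕ (b i j) else 0)

  -- Passes from the Boolean selections of the definition to the recursive form, which is easier to
  -- split and merge.
  selectionSum-subsetSum : ∀ {m} L (eq : length L ≡ m) (s : Fin m → Bool) →
                           SubsetSum L (selectionSum s (family L eq))
  selectionSum-subsetSum []      refl s = λ j → divides 0ℤ refl
  selectionSum-subsetSum (y ∷ L) refl s = head-cases (s zero) refl
    where
    tail total : V
    tail  = selectionSum (s ∘ suc) (family L refl)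
    total = selectionSum s (family (y ∷ L) refl)
    total≐ : ∀ {b} → s zero ≡ b → ∀ j → total j ≡ + (if b then toℕ (reduce y j) else 0) ℤ.+ tail j
    total≐ refl j = cong +_ (∑-suc (length L) _)
    identity : ∀ y t → t ≡ y ℤ.+ t ℤ.- y
    identity = ℤRing.solve-∀
    rest : SubsetSum L tail
    rest = selectionSum-subsetSum L refl (s ∘ suc)
    head-cases : ∀ b → s zero ≡ b → SubsetSum (y ∷ L) total
    head-cases false e = inj₁ (subsetSum-≋ L (≐⇒≋ {tail} λ j → sym (total≐ e j)) rest)
    head-cases true  e = inj₂ (subsetSum-≋ L {tail} {total ⊖ y}
      (≋-trans {tail} {total ⊖ embed (reduce y)} {total ⊖ y}
        (≐⇒≋ {tail} λ j → trans (identity (+ toℕ (reduce y j)) (tail j)) (cong (ℤ._- + toℕ (reduce y j)) (sym (total≐ e j))))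
        (⊖-cong {total} {total} {embed (reduce y)} {y} (≐⇒≋ {total} λ j → refl) (embed-reduce y))) rest)

  vsum : ∀ M → (Fin M → V) → V
  vsum zero    z = 𝟎
  vsum (suc M) z = z zero ⊕ vsum M (z ∘ suc)

  vsum∈span : ∀ L M z → (∀ t → Span L (z t)) → Span L (vsum M z)
  vsum∈span L zero    z z∈ = span-𝟎 L
  vsum∈span L (suc M) z z∈ = span-⊕ L (z∈ zero) (vsum∈span L M (z ∘ suc) (z∈ ∘ suc))

  vsum-⊖ : ∀ M x y → vsum M (λ t → x t ⊖ y t) ≐ vsum M x ⊖ vsum M y
  vsum-⊖ zero    x y j = refl
  vsum-⊖ (suc M) x y j = trans (cong (λ z → x zero j ℤ.- y zero j ℤ.+ z) (vsum-⊖ M (x ∘ suc) (y ∘ suc) j))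
    (identity (x zero j) (y zero j) _ _)
    where
    identity : ∀ x y X Y → x ℤ.- y ℤ.+ (X ℤ.- Y) ≡ x ℤ.+ X ℤ.- (y ℤ.+ Y)
    identity = ℤRing.solve-∀

  ∑≐vsum : ∀ M (f : Fin M → Fin d → ℕ) → (λ j → + ∑ M (λ t → f t j)) ≐ vsum M (λ t j → + f t j)
  ∑≐vsum zero    f j = refl
  ∑≐vsum (suc M) f j = trans (cong +_ (∑-suc M _)) (cong (λ z → + f zero j ℤ.+ z) (∑≐vsum M (f ∘ suc) j))

  -- The bases L t of Span b are completed by one common complement C;
  -- a subset sum lying in Span b has no component along C.
  subsetSums-cover : ∀ {M} → FProperty p d M → ∀ b (L : Fin M → List V) → S.Indep b →
    (∀ t → S.Indep (L t)) → (∀ t → All (Span b) (L t)) → (∀ t → length (L t) ≡ length b) →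
    ∀ x → Span b x → ∃ λ (z : Fin M → V) → (∀ t → SubsetSum (L t) (z t)) × vsum M z ≋ x
  subsetSums-cover {M} fp b L ind indL L⊑b len x x∈b with extend-basis b ind
  ... | C , indC , lenC = z , proj₂ ∘ proj₂ ∘ splits , z≋x
    where
    lenCL : ∀ t → length (C ++ L t) ≡ d
    lenCL t = trans (length-++ C) (trans (cong (λ n → length C + n) (len t)) (trans (sym (length-++ C)) lenC))
    indCL : ∀ t → S.Indep (C ++ L t)
    indCL t = S.indep-++-⊑ C (S.cl-trans (All.lookup (L⊑b t))) (indL t) indC
    -- The property defining f(p,d) concerns bases of the whole space, such as `C ++ L t`.
    selection = fp (λ t → family (C ++ L t) (lenCL t))
      (λ t → family-independent (C ++ L t) (lenCL t) (indCL t) ,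
             family-spanning (C ++ L t) (lenCL t) (full-spans (indCL t) (lenCL t)))
      (reduce x)
    s = proj₁ selection
    u : Fin M → V
    u t = selectionSum (s t) (family (C ++ L t) (lenCL t))
    splits : ∀ t → ∃ λ y → SubsetSum C y × SubsetSum (L t) (u t ⊖ y)
    splits t = subsetSum-++ C (selectionSum-subsetSum (C ++ L t) (lenCL t) (s t))
    y z : Fin M → V
    y t = proj₁ (splits t)
    z t = u t ⊖ y t
    u≋x : vsum M u ≋ x
    u≋x = ≋-trans {vsum M u} {embed (reduce x)} {x}
      (≋-trans {vsum M u} (≐⇒≋ {vsum M u} λ j → sym (∑≐vsum M _ j)) λ j →
        mod⇒∣- {∑ M (λ t → ∑ d (λ i → if s t i then toℕ (family (C ++ L t) (lenCL t) i j) else 0))} {toℕ (reduce x j)}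
          (proj₂ selection j))
      (embed-reduce x)
    z∈b : Span b (vsum M z)
    z∈b = vsum∈span b M z λ t → subsetSum⇒span (L⊑b t) (proj₂ (proj₂ (splits t)))
    y∈C : Span C (vsum M y)
    y∈C = vsum∈span C M y λ t → subsetSum⇒span (All.tabulate span-∈) (proj₁ (proj₂ (splits t)))
    y≋ : x ⊖ vsum M z ≋ vsum M y
    y≋ = ≋-trans {x ⊖ vsum M z} {vsum M u ⊖ vsum M z} {vsum M y}
      (⊖-cong {x} {vsum M u} {vsum M z} (≋-sym {vsum M u} u≋x) (≐⇒≋ {vsum M z} λ j → refl))
      (≐⇒≋ {vsum M u ⊖ vsum M z} λ j → trans (cong (λ w → vsum M u j ℤ.- w) (vsum-⊖ M u y j))
        (identity (vsum M u j) (vsum M y j)))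
      where
      identity : ∀ u y → u ℤ.- (u ℤ.- y) ≡ y
      identity = ℤRing.solve-∀
    -- By `y≋`, the vector `vsum M y` is a difference of two elements of `Span b`. It also lies in
    -- `Span C`, and the two spans meet only in zero.
    y≋0 : Span [] (vsum M y)
    y≋0 = independent-intersection C indC y∈C (span-≋ b y≋ (span-⊖ b x∈b z∈b))
    z≋x : vsum M z ≋ x
    z≋x = ≋-trans {vsum M z} {vsum M u} {x}
      (λ j → subst (+ p ∣_) (trans (identity (vsum M u j) (vsum M y j)) (cong (ℤ._- vsum M u j) (sym (vsum-⊖ M u y j))))
        (∣n⇒∣m*n (ℤ.- 1ℤ) (y≋0 j)))
      u≋x
      where
      identity : ∀ u y → (ℤ.- 1ℤ) ℤ.* y ≡ u ℤ.- y ℤ.- u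
      identity = ℤRing.solve-∀

-- Finite sums and cycles

∑-cong : ∀ m {f g : Fin m → ℕ} → (∀ i → f i ≡ g i) → ∑ m f ≡ ∑ m g
∑-cong zero    e = refl
∑-cong (suc m) {f} {g} e = trans (∑-suc m f) (trans (cong₂ _+_ (e zero) (∑-cong m (e ∘ suc))) (sym (∑-suc m g)))

∑-zero : ∀ m → ∑ m (λ _ → 0) ≡ 0
∑-zero zero    = refl
∑-zero (suc m) = trans (∑-suc m (λ _ → 0)) (∑-zero m)

∑-last : ∀ m (f : Fin (suc m) → ℕ) → ∑ (suc m) f ≡ ∑ m (f ∘ inject₁) + f (fromℕ m)
∑-last zero    f = ℕ.+-comm (f zero) 0
∑-last (suc m) f = begin
  ∑ (suc (suc m)) f                                              ≡⟨ ∑-suc (suc m) f ⟩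
  f zero + ∑ (suc m) (f ∘ suc)                                   ≡⟨ cong (λ k → f zero + k) (∑-last m (f ∘ suc)) ⟩
  f zero + (∑ m (f ∘ suc ∘ inject₁) + f (fromℕ (suc m)))         ≡⟨ sym (ℕ.+-assoc (f zero) _ _) ⟩
  f zero + ∑ m (f ∘ suc ∘ inject₁) + f (fromℕ (suc m))           ≡⟨ cong (_+ f (fromℕ (suc m))) (sym (∑-suc m (f ∘ inject₁))) ⟩
  ∑ (suc m) (f ∘ inject₁) + f (fromℕ (suc m))                    ∎
  where open ≡-Reasoning

∑-bump : ∀ m s {f g : Fin m → ℕ} → f s ≡ suc (g s) → (∀ t → s ≢ t → f t ≡ g t) → ∑ m f ≡ suc (∑ m g)
∑-bump (suc m) zero    {f} {g} e es = trans (∑-suc m f)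
  (trans (cong₂ _+_ e (∑-cong m λ t → es (suc t) λ ())) (cong suc (sym (∑-suc m g))))
∑-bump (suc m) (suc s) {f} {g} e es = trans (∑-suc m f)
  (trans (cong₂ _+_ (es zero λ ()) (∑-bump m s e λ t s≢t → es (suc t) (s≢t ∘ Fin.suc-injective)))
    (trans (ℕ.+-suc (g zero) _) (cong suc (sym (∑-suc m g)))))

-- The smallest value is at most the average.
∑-min : ∀ m → 1 ≤ m → (f : Fin m → ℕ) → ∃ λ t → m * f t ≤ ∑ m f
∑-min (suc zero)    _ f = zero , ℕ.≤-refl
∑-min (suc (suc m)) _ f with ∑-min (suc m) (s≤s z≤n) (f ∘ suc)
... | t , le with ℕ.≤-total (f zero) (f (suc t))
...   | inj₁ f0≤ = zero , subst (f zero + suc m * f zero ≤_) (sym (∑-suc (suc m) f))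
                     (ℕ.+-monoʳ-≤ (f zero) (ℕ.≤-trans (ℕ.*-monoʳ-≤ (suc m) f0≤) le))
...   | inj₂ ft≤ = suc t , subst (f (suc t) + suc m * f (suc t) ≤_) (sym (∑-suc (suc m) f)) (ℕ.+-mono-≤ ft≤ le)

∑-≤ : ∀ m w (f : Fin m → ℕ) → (∀ t → f t ≤ w) → ∑ m f ≤ m * w
∑-≤ zero    w f f≤ = z≤n
∑-≤ (suc m) w f f≤ = subst (_≤ suc m * w) (sym (∑-suc m f)) (ℕ.+-mono-≤ (f≤ zero) (∑-≤ m w (f ∘ suc) (f≤ ∘ suc)))

∑-saturated : ∀ m w (f : Fin m → ℕ) → (∀ t → f t ≤ w) → (∀ t → f t ≡ w) ⊎ ∑ m f < m * w
∑-saturated zero    w f f≤ = inj₁ λ ()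
∑-saturated (suc m) w f f≤ with ℕ.m≤n⇒m<n∨m≡n (f≤ zero) | ∑-saturated m w (f ∘ suc) (f≤ ∘ suc)
... | inj₁ f0< | _        = inj₂ (subst (_< suc m * w) (sym (∑-suc m f)) (ℕ.+-mono-<-≤ f0< (∑-≤ m w (f ∘ suc) (f≤ ∘ suc))))
... | inj₂ f0≡ | inj₂ lt  = inj₂ (subst (_< suc m * w) (sym (∑-suc m f)) (ℕ.+-mono-≤-< (f≤ zero) lt))
... | inj₂ f0≡ | inj₁ all = inj₁ λ { zero → f0≡ ; (suc t) → all t }

next-inject₁ : ∀ {ℓ} (i : Fin ℓ) → next (inject₁ i) ≡ suc i
next-inject₁ {ℓ} i = Fin.toℕ-injective (trans (Fin.toℕ-fromℕ< _)
  (trans (cong (λ k → suc k ℕ.% suc ℓ) (Fin.toℕ-inject₁ i)) (ℕ.m<n⇒m%n≡m (s≤s (Fin.toℕ<n i)))))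

next-fromℕ : ∀ ℓ → next (fromℕ ℓ) ≡ zero
next-fromℕ ℓ = Fin.toℕ-injective (trans (Fin.toℕ-fromℕ< _)
  (trans (cong (λ k → suc k ℕ.% suc ℓ) (Fin.toℕ-fromℕ ℓ)) (ℕ.n%n≡0 (suc ℓ))))

walkSum : {A : Set} → (A → A → ℕ) → A → List A → A → ℕ
walkSum f u []       z = f u z
walkSum f u (v ∷ vs) z = f u v + walkSum f v vs z

∑-walk : ∀ {A : Set} (f : A → A → ℕ) x ys z →
  ∑ (length ys) (λ i → f (lookup (x ∷ ys) (inject₁ i)) (lookup ys i)) + f (lookup (x ∷ ys) (fromℕ (length ys))) z
  ≡ walkSum f x ys z
∑-walk f x []       z = refl
∑-walk f x (y ∷ ys) z = trans (cong (_+ f (lookup (y ∷ ys) (fromℕ (length ys))) z) (∑-suc (length ys) step))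
  (trans (ℕ.+-assoc (f x y) (∑ (length ys) (step ∘ suc)) _) (cong (λ k → f x y + k) (∑-walk f y ys z)))
  where
  step : Fin (length (y ∷ ys)) → ℕ
  step i = f (lookup (x ∷ y ∷ ys) (inject₁ i)) (lookup (y ∷ ys) i)

-- Only at the last index does `next` wrap around; splitting that term off leaves a walk along
-- consecutive entries.
∑-cycle : ∀ {A : Set} (f : A → A → ℕ) x ys →
  ∑ (suc (length ys)) (λ i → f (lookup (x ∷ ys) i) (lookup (x ∷ ys) (next i))) ≡ walkSum f x ys x
∑-cycle {A} f x ys = trans (∑-last (length ys) (λ i → f (v i) (v (next i)))) (trans
  (cong₂ _+_ (∑-cong (length ys) λ i → cong (λ k → f (v (inject₁ i)) (v k)) (next-inject₁ i))
             (cong (λ k → f (v (fromℕ (length ys))) (v k)) (next-fromℕ (length ys))))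
  (∑-walk f x ys x))
  where
  v : Fin (suc (length ys)) → A
  v = lookup (x ∷ ys)

-- Direct sum of copies of a matroid

module Coloured {V E : Set} (S : Matroid V) (M : ℕ) (vec : E → V) where
  private module S = MatroidProperties S

  part : Fin M → List (Fin M × E) → List V
  part t [] = []
  part t ((s , e) ∷ K) with s Fin.≟ t
  ... | yes _ = vec e ∷ part t K
  ... | no  _ = part t K

  part-same : ∀ t e K → part t ((t , e) ∷ K) ≡ vec e ∷ part t K
  part-same t e K with t Fin.≟ t
  ... | yes _ = refl
  ... | no ¬r = contradiction refl ¬r

  part-other : ∀ {s t} → s ≢ t → ∀ e K → part t ((s , e) ∷ K) ≡ part t K
  part-other {s} {t} s≢t e K with s Fin.≟ t
  ... | yes s≡t = contradiction s≡t s≢t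
  ... | no _    = refl

  ∈-part⁺ : ∀ {t e} K → (t , e) ∈ K → vec e ∈ part t K
  ∈-part⁺ {t} {e} (_ ∷ K) (here refl) = subst (vec e ∈_) (sym (part-same t e K)) (here refl)
  ∈-part⁺ {t} ((s , f) ∷ K) (there i) with s Fin.≟ t
  ... | yes _ = there (∈-part⁺ K i)
  ... | no  _ = ∈-part⁺ K i

  ∈-part⁻ : ∀ {t v} K → v ∈ part t K → ∃ λ e → (t , e) ∈ K × v ≡ vec e
  ∈-part⁻ {t} ((s , e) ∷ K) i with s Fin.≟ t
  ∈-part⁻ ((s , e) ∷ K) (here refl) | yes refl = e , here refl , refl
  ∈-part⁻ ((s , e) ∷ K) (there i)   | yes _ with ∈-part⁻ K i
  ... | f , j , eq = f , there j , eq
  ∈-part⁻ ((s , e) ∷ K) i           | no _  with ∈-part⁻ K i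
  ... | f , j , eq = f , there j , eq

  colouredCl : List (Fin M × E) → Fin M × E → Set
  colouredCl K (t , e) = S.Cl (part t K) (vec e)

  -- An element of another colour does not affect the closure in the colour of `x`, so `x` and `y`
  -- share their colour.
  exchange-parts : ∀ {L x y} → colouredCl (y ∷ L) x → ¬ colouredCl L x → colouredCl (x ∷ L) y
  exchange-parts {L} {t , e} {s , f} x∈ x∉ with s Fin.≟ t
  ... | no  s≢t  = contradiction x∈ x∉
  ... | yes refl = subst (λ P → S.Cl P (vec f)) (sym (part-same s e L)) (S.cl-exchange x∈ x∉)

  coloured : Matroid (Fin M × E)
  coloured = record
    { Cl          = colouredCl
    ; cl?         = λ { K (t , e) → S.cl? (part t K) (vec e) }
    ; cl-∈        = λ {K} i → S.cl-∈ (∈-part⁺ K i)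
    ; cl-trans    = λ {K} {K'} K⊑K' → S.cl-trans λ i → case ∈-part⁻ K i of λ { (e , j , refl) → K⊑K' j }
    ; cl-exchange = λ {L} {x} {y} → exchange-parts {L} {x} {y}
    }

  private module C = MatroidProperties coloured

  part-indep : ∀ K → C.Indep K → ∀ t → S.Indep (part t K)
  part-indep []            _          t = tt
  part-indep ((s , e) ∷ K) (e∉ , ind) t with s Fin.≟ t
  ... | yes refl = e∉ , part-indep K ind t
  ... | no  _    = part-indep K ind t

  ∑-part : ∀ K → ∑ M (λ t → length (part t K)) ≡ length K
  ∑-part []            = ∑-zero M
  ∑-part ((s , e) ∷ K) = trans
    (∑-bump M s (cong length (part-same s e K)) (λ t s≢t → cong length (part-other s≢t e K)))
    (cong suc (∑-part K))

-- Distinct entries and fresh vertices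

lookup-injective : ∀ {A : Set} {xs : List A} → Unique xs → ∀ {i j} → lookup xs i ≡ lookup xs j → i ≡ j
lookup-injective (_  ∷ _)  {zero}  {zero}  _ = refl
lookup-injective (x∉ ∷ _)  {zero}  {suc j} e = contradiction e (All.lookup x∉ (∈-lookup j))
lookup-injective (x∉ ∷ _)  {suc i} {zero}  e = contradiction (sym e) (All.lookup x∉ (∈-lookup i))
lookup-injective (_  ∷ us) {suc i} {suc j} e = cong suc (lookup-injective us e)

_∈?_ : ∀ {n} (v : Fin n) F → Dec (v ∈ F)
v ∈? F = Any.any? (v Fin.≟_) F

-- Pigeonhole: were every vertex listed, its position would give an injection of `Fin n` into the
-- positions of `F`.
fresh : ∀ {n} (F : List (Fin n)) → length F < n → ∃ λ v → v ∉ F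
fresh {n} F F<n with Fin.any? (λ v → ¬? (v ∈? F))
... | yes v∉ = v∉
... | no  ¬∃ = contradiction (Fin.injective⇒≤ {f = Any.index ∘ covered} index-injective) (ℕ.<⇒≱ F<n)
  where
  covered : ∀ v → v ∈ F
  covered v = decidable-stable (v ∈? F) λ v∉ → ¬∃ (v , v∉)
  index-injective : ∀ {u v} → Any.index (covered u) ≡ Any.index (covered v) → u ≡ v
  index-injective {u} {v} e = trans (Any.lookup-index (covered u)) (trans (cong (lookup F) e)
    (sym (Any.lookup-index (covered v))))

-- Gadgets and zero-sum cycles

module Gadgets (p d : ℕ) (pr : Prime p) (M : ℕ) (1≤M : 1 ≤ M) (fp : FProperty p d M)
               (n : ℕ) (w : Labelling p d n) where
  open Linear p d pr
  open Bases p d pr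

  W : Fin n → Fin n → V
  W x y j = + toℕ (w x y j)

  Gadget : Set
  Gadget = Fin n × Fin n × Fin n

  diff : Gadget → V
  diff (a , b , c) = W a b ⊕ W b c ⊖ W a c

  -- The colour is ignored, so gadgets of different colours in a packing are disjoint too; no gadget
  -- is used in two colours.
  verts : Fin M × Gadget → List (Fin n)
  verts (_ , a , b , c) = a ∷ b ∷ c ∷ []

  open Coloured spanMatroid M diff
  open Packing coloured Fin._≟_ (Unique ∘ verts) verts (λ _ → refl)
  module C = MatroidProperties coloured

  avoids? : ∀ F e → Dec (Avoids F e)
  avoids? F e = unique? (verts e) ×-dec
    map′ (λ a (i , j) → All.lookup a i j) (λ dis → All.tabulate λ i j → dis (i , j))
      (All.all? (λ v → ¬? (v ∈? F)) (verts e))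
    where open DecUnique (Fin._≟_ {n}) using (unique?)

  search : Search
  search F K with Fin.any? (λ t → Fin.any? λ a → Fin.any? λ b → Fin.any? λ c →
                    avoids? F (t , a , b , c) ×-dec ¬? (C.cl? K (t , a , b , c)))
  ... | yes (t , a , b , c , av , ∉) = inj₁ ((t , a , b , c) , av , ∉)
  ... | no ¬∃ = inj₂ λ { (t , a , b , c) av →
          decidable-stable (C.cl? K (t , a , b , c)) λ ∉ → ¬∃ (t , a , b , c , av , ∉) }

  Balanced : List (Fin n) → List V → Set
  Balanced F b = ∀ e → Avoids F e → Span b (diff (proj₂ e))

  weight : Fin n → List (Fin n) → Fin n → V
  weight u []       z = W u z
  weight u (v ∷ vs) z = W u v ⊕ weight v vs z

  weight-walkSum : ∀ u vs z → weight u vs z ≐ λ j → + walkSum (λ x y → toℕ (w x y j)) u vs z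
  weight-walkSum u []       z j = refl
  weight-walkSum u (v ∷ vs) z j = cong (λ k → W u v j ℤ.+ k) (weight-walkSum v vs z j)

  zero-cycle : ∀ x y ys → Unique (x ∷ y ∷ ys) → Span [] (weight x (y ∷ ys) x) → HasZeroSumCycle p d n w
  zero-cycle x y ys uniq zero-weight = length ys , lookup (x ∷ y ∷ ys) , lookup-injective uniq ,
    λ j → subst (_≡ 0 [mod p ]) (sym (∑-cycle (λ u v → toℕ (w u v j)) x (y ∷ ys)))
            (∣-⇒mod {walkSum (λ u v → toℕ (w u v j)) x (y ∷ ys) x} {0}
              (subst (+ p ∣_) (trans (weight-walkSum x (y ∷ ys) x j) (sym (ℤ.+-identityʳ _))) (zero-weight j)))

  -- An arbitrary colour, for places where any colour will do.
  t₀ : Fin M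
  t₀ = fromℕ< 1≤M

  module _ {F b} (bal : Balanced F b) where

    triangle : ∀ {x y z} → Unique (x ∷ y ∷ z ∷ []) → All (_∉ F) (x ∷ y ∷ z ∷ []) → Span b (W x y ⊕ W y z ⊖ W x z)
    triangle {x} {y} {z} uniq av = bal (t₀ , x , y , z) (uniq , λ (i , j) → All.lookup av i j)

    -- The differences of the gadgets (x, y, z) and (y, x, z) add up to the weight of the 2-cycle;
    -- this takes a third vertex `z` outside `F`.
    two-cycle : ∀ {x y z} → Unique (x ∷ y ∷ z ∷ []) → All (_∉ F) (x ∷ y ∷ z ∷ []) → Span b (W x y ⊕ W y x)
    two-cycle {x} {y} {z} u@((x≢y ∷ x≢z ∷ []) ∷ (y≢z ∷ []) ∷ [] ∷ []) a@(ax ∷ ay ∷ az ∷ []) =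
      span-≐ b (λ j → identity (W x y j) (W y x j) (W y z j) (W x z j))
        (span-⊕ b (triangle u a) (triangle (((x≢y ∘ sym) ∷ y≢z ∷ []) ∷ (x≢z ∷ []) ∷ [] ∷ []) (ay ∷ ax ∷ az ∷ [])))
      where
      identity : ∀ xy yx yz xz → xy ℤ.+ yz ℤ.- xz ℤ.+ (yx ℤ.+ xz ℤ.- yz) ≡ xy ℤ.+ yx
      identity = ℤRing.solve-∀

    -- A gadget shortens x y y' to x y' at the cost of a vector in `Span b`, until a 2-cycle
    -- remains; `z` is the third vertex for that 2-cycle.
    closed-walk : ∀ {z} x y ys → Unique (z ∷ x ∷ y ∷ ys) → All (_∉ F) (z ∷ x ∷ y ∷ ys) → Span b (weight x (y ∷ ys) x)
    closed-walk x y [] ((z≢x ∷ z≢y ∷ []) ∷ (x≢y ∷ []) ∷ [] ∷ []) (az ∷ ax ∷ ay ∷ []) =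
      two-cycle ((x≢y ∷ (z≢x ∘ sym) ∷ []) ∷ ((z≢y ∘ sym) ∷ []) ∷ [] ∷ []) (ax ∷ ay ∷ az ∷ [])
    closed-walk x y (y' ∷ ys) ((z≢x ∷ z≢y ∷ z≢) ∷ (x≢y ∷ x≢y' ∷ x≢) ∷ (y≢y' ∷ y≢) ∷ us) (az ∷ ax ∷ ay ∷ ay' ∷ as) =
      span-≐ b (λ j → identity (W x y j) (W y y' j) (W x y' j) (weight y' ys x j))
        (span-⊕ b (triangle ((x≢y ∷ x≢y' ∷ []) ∷ (y≢y' ∷ []) ∷ [] ∷ []) (ax ∷ ay ∷ ay' ∷ []))
                  (closed-walk x y' ys ((z≢x ∷ z≢) ∷ (x≢y' ∷ x≢) ∷ us) (az ∷ ax ∷ ay' ∷ as)))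
      where
      identity : ∀ xy yy' xy' r → xy ℤ.+ yy' ℤ.- xy' ℤ.+ (xy' ℤ.+ r) ≡ xy ℤ.+ (yy' ℤ.+ r)
      identity = ℤRing.solve-∀

  flat : List (Fin M × Gadget) → List (Fin n)
  flat []      = []
  flat (e ∷ K) = verts e ++ flat K

  -- The walk before any detour: the middle vertex of each gadget is left free for later insertion.
  short : List (Fin M × Gadget) → List (Fin n)
  short []                      = []
  short ((_ , a , _ , c) ∷ K) = a ∷ c ∷ short K

  short⊆flat : ∀ K → short K Sublist.⊆ flat K
  short⊆flat []                    = Sublist.[]
  short⊆flat ((_ , a , b , c) ∷ K) = refl Sublist.∷ (b Sublist.∷ʳ (refl Sublist.∷ short⊆flat K))

  ∈-flat⁻ : ∀ K {x} → x ∈ flat K → ∃ λ e → e ∈ K × x ∈ verts e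
  ∈-flat⁻ (e ∷ K) i with ∈-++⁻ (verts e) i
  ... | inj₁ j = e , here refl , j
  ... | inj₂ j with ∈-flat⁻ K j
  ...   | f , k , l = f , there k , l

  flat-avoids : ∀ {F} K → Packed F K → All (_∉ F) (flat K)
  flat-avoids K pk = All.tabulate λ i j →
    case ∈-flat⁻ K i of λ { (e , e∈ , k) → proj₂ (All.lookup (avoids pk) e∈) (k , j) }

  flat-unique : ∀ {F} K → Packed F K → Unique (flat K)
  flat-unique []      _  = []
  flat-unique (e ∷ K) (packed ((ue , _) ∷ avs) (ap ∷ aps)) = Unique.++⁺ ue (flat-unique K (packed avs aps))
    λ (i , j) → case ∈-flat⁻ K j of λ { (f , f∈ , k) → All.lookup ap f∈ (i , k) }

  -- For a chosen gadget (a, b, c) the walk takes a b c instead of a c.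
  detours : ∀ K {x} → SubsetSum (map (diff ∘ proj₂) K) x → ∀ u z →
            ∃ λ vs → vs Sublist.⊆ flat K × weight u vs z ≋ weight u (short K) z ⊕ x
  detours [] {x} s u z = [] , Sublist.[] , λ j → subst (+ p ∣_) (identity (W u z j) (x j)) (∣n⇒∣m*n (ℤ.- 1ℤ) (s j))
    where
    identity : ∀ w x → (ℤ.- 1ℤ) ℤ.* x ≡ w ℤ.- (w ℤ.+ x)
    identity = ℤRing.solve-∀
  detours ((_ , a , b , c) ∷ K) {x} (inj₁ s) u z with detours K s c z
  ... | vs , sub , e = a ∷ c ∷ vs , refl Sublist.∷ (b Sublist.∷ʳ (refl Sublist.∷ sub)) ,
        λ j → subst (+ p ∣_) (identity (W u a j) (W a c j) (weight c vs z j) (weight c (short K) z j) (x j)) (e j)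
    where
    identity : ∀ ua ac v s x → v ℤ.- (s ℤ.+ x) ≡ ua ℤ.+ (ac ℤ.+ v) ℤ.- (ua ℤ.+ (ac ℤ.+ s) ℤ.+ x)
    identity = ℤRing.solve-∀
  detours ((_ , a , b , c) ∷ K) {x} (inj₂ s) u z with detours K s c z
  ... | vs , sub , e = a ∷ b ∷ c ∷ vs , refl Sublist.∷ (refl Sublist.∷ (refl Sublist.∷ sub)) ,
        λ j → subst (+ p ∣_)
          (identity (W u a j) (W a b j) (W b c j) (W a c j) (weight c vs z j) (weight c (short K) z j) (x j)) (e j)
    where
    identity : ∀ ua ab bc ac v s x → v ℤ.- (s ℤ.+ (x ℤ.- (ab ℤ.+ bc ℤ.- ac)))
                 ≡ ua ℤ.+ (ab ℤ.+ (bc ℤ.+ v)) ℤ.- (ua ℤ.+ (ac ℤ.+ s) ℤ.+ x)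
    identity = ℤRing.solve-∀

  vsum-cong : ∀ m {y z} → (∀ t → y t ≐ z t) → vsum m y ≐ vsum m z
  vsum-cong zero    e j = refl
  vsum-cong (suc m) e j = cong₂ ℤ._+_ (e zero j) (vsum-cong m (e ∘ suc) j)

  vsum-update : ∀ m s {y z} v → y s ≐ z s ⊖ v → (∀ t → s ≢ t → y t ≐ z t) → vsum m y ≐ vsum m z ⊖ v
  vsum-update (suc m) zero    {y} {z} v e es j =
    trans (cong₂ ℤ._+_ (e j) (vsum-cong m (λ t → es (suc t) λ ()) j)) (identity (z zero j) (v j) _)
    where
    identity : ∀ z v r → z ℤ.- v ℤ.+ r ≡ z ℤ.+ r ℤ.- v
    identity = ℤRing.solve-∀
  vsum-update (suc m) (suc s) {y} {z} v e es j =
    trans (cong₂ ℤ._+_ (es zero (λ ()) j) (vsum-update m s v e (λ t s≢t → es (suc t) (s≢t ∘ Fin.suc-injective)) j))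
          (sym (ℤ.+-assoc (z zero j) _ _))

  -- Whether the first gadget is chosen is read off in its own colour. The result is a single
  -- selection in the order of `K`, the order followed by `detours`.
  merge-colours : ∀ K z → (∀ t → SubsetSum (part t K) (z t)) → SubsetSum (map (diff ∘ proj₂) K) (vsum M z)
  merge-colours []            z ss = vsum∈span [] M z ss
  merge-colours ((s , g) ∷ K) z ss with subst (λ P → SubsetSum P (z s)) (part-same s g K) (ss s)
  ... | inj₁ s₀ = inj₁ (merge-colours K z ss₀)
    where
    ss₀ : ∀ t → SubsetSum (part t K) (z t)
    ss₀ t with s Fin.≟ t
    ... | yes refl = s₀
    ... | no  s≢t  = subst (λ P → SubsetSum P (z t)) (part-other s≢t g K) (ss t)
  ... | inj₂ s₁ = inj₂ (subsetSum-≋ (map (diff ∘ proj₂) K) {vsum M y}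
          (≐⇒≋ {vsum M y} (vsum-update M s (diff g) y-same y-other)) (merge-colours K y ss₁))
    where
    y : Fin M → V
    y t with s Fin.≟ t
    ... | yes _ = z t ⊖ diff g
    ... | no  _ = z t
    y-same : y s ≐ z s ⊖ diff g
    y-same j with s Fin.≟ s
    ... | yes _ = refl
    ... | no ¬r = contradiction refl ¬r
    y-other : ∀ t → s ≢ t → y t ≐ z t
    y-other t s≢t j with s Fin.≟ t
    ... | yes s≡t = contradiction s≡t s≢t
    ... | no  _   = refl
    ss₁ : ∀ t → SubsetSum (part t K) (y t)
    ss₁ t with s Fin.≟ t
    ... | yes refl = s₁
    ... | no  s≢t  = subst (λ P → SubsetSum P (z t)) (part-other s≢t g K) (ss t)

  Full : List V → List (Fin M × Gadget) → Set
  Full b K = ∀ t → length (part t K) ≡ length b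

  part⊑ : ∀ {F b K} → Balanced F b → Packed F K → ∀ t → All (Span b) (part t K)
  part⊑ {K = K} bal pk t = All.tabulate λ i → case ∈-part⁻ K i of λ
    { (g , j , refl) → bal (t , g) (All.lookup (avoids pk) j) }

  full-cycle : ∀ {F b} K → S.Indep b → 3 + length F ≤ n → Balanced F b → Packed F K → C.Indep K → Full b K →
               HasZeroSumCycle p d n w
  -- Without gadgets `b` is empty, so a 2-cycle outside `F` has weight zero; the third fresh vertex
  -- is the one that `two-cycle` asks for.
  full-cycle {F} {b} [] ind room bal pk indK full
    with fresh F (ℕ.≤-trans (ℕ.m≤n+m _ 2) room)
  ... | x , x∉ with fresh (x ∷ F) (ℕ.≤-trans (ℕ.m≤n+m _ 1) room)
  ... | y , y∉ with fresh (y ∷ x ∷ F) room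
  ... | z , z∉ = zero-cycle x y [] ((x≢y ∷ []) ∷ [] ∷ [])
        (subst (λ b → Span b (W x y ⊕ W y x)) (empty b (full t₀))
          (two-cycle {F} {b} bal ((x≢y ∷ (λ e → z∉ (there (here (sym e)))) ∷ []) ∷
            ((λ e → z∉ (here (sym e))) ∷ []) ∷ [] ∷ [])
            (x∉ ∷ (y∉ ∘ there) ∷ (z∉ ∘ there ∘ there) ∷ [])))
    where
    x≢y : x ≢ y
    x≢y e = y∉ (here (sym e))
    empty : ∀ b → 0 ≡ length b → b ≡ []
    empty [] _ = refl
  full-cycle {F} {b} (e@(t , a , m , c) ∷ K) ind room bal pk indK full = build (merge-colours (e ∷ K) z ss)
    where
    base : V
    base = weight a (c ∷ short K) a
    flat-uniq : Unique (a ∷ m ∷ c ∷ flat K)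
    flat-uniq = flat-unique (e ∷ K) pk
    base∈b : Span b base
    base∈b with flat-uniq | flat-avoids (e ∷ K) pk
    ... | (a≢m ∷ a≢) ∷ m≢ ∷ us | a∉ ∷ m∉ ∷ ∉s =
      -- The cycle skips the middle vertex `m`, which can therefore be the spare one.
      closed-walk {F} {b} bal {m} a c (short K)
        (((a≢m ∘ sym) ∷ Sublist.All-resp-⊆ c∷short⊆ m≢) ∷ Sublist.All-resp-⊆ c∷short⊆ a≢ ∷ allPairs-resp-⊆ c∷short⊆ us)
        (m∉ ∷ a∉ ∷ Sublist.All-resp-⊆ c∷short⊆ ∉s)
      where
      c∷short⊆ : c ∷ short K Sublist.⊆ c ∷ flat K
      c∷short⊆ = refl Sublist.∷ short⊆flat K
    -- The correction wanted is minus the weight of the cycle without detours.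
    cover = subsetSums-cover fp b (λ t → part t (e ∷ K)) ind (part-indep (e ∷ K) indK) (part⊑ {F} {b} bal pk) full
              ((ℤ.- 1ℤ) ⊙ base) (span-⊙ b (ℤ.- 1ℤ) base∈b)
    z  = proj₁ cover
    ss = proj₁ (proj₂ cover)
    -- The first gadget is treated apart because the cycle starts at its vertex `a`; `detours`
    -- supplies the walk from `c` back to `a`.
    build : SubsetSum (map (diff ∘ proj₂) (e ∷ K)) (vsum M z) → HasZeroSumCycle p d n w
    build (inj₁ s) with detours K s c a
    ... | vs , sub , r =
          zero-cycle a c vs (allPairs-resp-⊆ (refl Sublist.∷ (m Sublist.∷ʳ (refl Sublist.∷ sub))) flat-uniq)
          λ j → subst (+ p ∣_) (identity (W a c j) (weight c vs a j) (weight c (short K) a j) (vsum M z j))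
                  (∣m∣n⇒∣m+n (r j) (proj₂ (proj₂ cover) j))
      where
      identity : ∀ ac v s x → v ℤ.- (s ℤ.+ x) ℤ.+ (x ℤ.- (ℤ.- 1ℤ) ℤ.* (ac ℤ.+ s)) ≡ ac ℤ.+ v
      identity = ℤRing.solve-∀
    build (inj₂ s) with detours K s c a
    ... | vs , sub , r =
          zero-cycle a m (c ∷ vs) (allPairs-resp-⊆ (refl Sublist.∷ (refl Sublist.∷ (refl Sublist.∷ sub))) flat-uniq)
          λ j → subst (+ p ∣_) (identity (W a m j) (W m c j) (W a c j) (weight c vs a j) (weight c (short K) a j) (vsum M z j))
                  (∣m∣n⇒∣m+n (r j) (proj₂ (proj₂ cover) j))
      where
      identity : ∀ am mc ac v s x →
        v ℤ.- (s ℤ.+ (x ℤ.- (am ℤ.+ mc ℤ.- ac))) ℤ.+ (x ℤ.- (ℤ.- 1ℤ) ℤ.* (ac ℤ.+ s)) ≡ am ℤ.+ (mc ℤ.+ v)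
      identity = ℤRing.solve-∀

  -- The extra 5 in `stuck` comes from a gadget still missing from the packing. It leaves room for
  -- the three vertices that `full-cycle` requires.
  data Grown (F : List (Fin n)) (b : List V) : Set where
    complete : ∀ K → Packed F K → C.Indep K → Full b K → Grown F b
    stuck : ∀ F' K → length F' + 5 * length K + 5 ≤ length F + 5 * (M * length b) →
            length K < M * length b → C.Indep K → (∀ e → Avoids F' e → C.Cl K e) → Grown F b

  -- `r` bounds the number of missing gadgets. No part exceeds the length of `b`, so either every
  -- part is a basis of `Span b` or the packing is below its full size and can be searched again.
  grow : ∀ {F b} → S.Indep b → Balanced F b → ∀ r K → Packed F K → C.Indep K →
         M * length b ≤ r + length K → Grown F b
  grow {F} {b} ind bal r K pk indK M≤
    with ∑-saturated M (length b) (λ t → length (part t K))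
           (λ t → S.steinitz (part-indep K indK t) (part⊑ {F} {b} bal pk t))
  ... | inj₁ eqs = complete K pk indK eqs
  ... | inj₂ lt with subst (_< M * length b) (∑-part K) lt
  ... | K< with r | solve search F K pk indK
  ... | zero  | _ = contradiction M≤ (ℕ.<⇒≱ K<)
  ... | suc r | found K' x eq pk' ind' _ =
          grow ind bal r (x ∷ K') pk' ind'
            (subst (M * length b ≤_) (trans (sym (ℕ.+-suc r _)) (cong (λ k → r + suc k) (sym eq))) M≤)
  ... | suc r | stuck F' K' le le' ind' all = stuck F' K' bound (ℕ.≤-<-trans le' K<) ind' all
    where
    open ℕ.≤-Reasoning
    identity : ∀ f k → f + 5 * k + 5 ≡ f + 5 * suc k
    identity = solve-∀
    bound : length F' + 5 * length K' + 5 ≤ length F + 5 * (M * length b)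
    bound = begin
      length F' + 5 * length K' + 5    ≤⟨ ℕ.+-monoˡ-≤ 5 le ⟩
      length F + 5 * length K + 5      ≡⟨ identity (length F) (length K) ⟩
      length F + 5 * suc (length K)    ≤⟨ ℕ.+-monoʳ-≤ (length F) (ℕ.*-monoʳ-≤ 5 K<) ⟩
      length F + 5 * (M * length b)    ∎

  -- Induction on the length of `b`, bounded by `k`. In the `stuck` case a part of at most average
  -- length is shorter than `b`, and it spans the differences of all gadgets avoiding `F'`.
  balanced-cycle : ∀ k F b → length b < k → S.Indep b → length F + 5 * (M * length b) ≤ n →
                   3 + length F ≤ n → Balanced F b → HasZeroSumCycle p d n w
  balanced-cycle (suc k) F b (s≤s b≤k) ind room room′ bal
    with grow {F} {b} ind bal (M * length b) [] (packed [] []) tt (ℕ.≤-reflexive (sym (ℕ.+-identityʳ _)))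
  ... | complete K pk indK full = full-cycle K ind room′ bal pk indK full
  ... | stuck F' K le K< indK all with ∑-min M 1≤M (λ t → length (part t K))
  ...   | t , min = balanced-cycle k F' (part t K)
            (ℕ.<-≤-trans (ℕ.*-cancelˡ-< M _ _ (ℕ.≤-<-trans min′ K<)) b≤k)
            (part-indep K indK t)
            (ℕ.≤-trans (ℕ.+-monoʳ-≤ (length F') (ℕ.*-monoʳ-≤ 5 min′)) (ℕ.≤-trans (ℕ.m≤m+n _ 5) room″))
            (ℕ.≤-trans (ℕ.≤-trans (ℕ.+-mono-≤ {3} {5} (s≤s (s≤s (s≤s z≤n))) (ℕ.m≤m+n (length F') (5 * length K)))
              (ℕ.≤-reflexive (ℕ.+-comm 5 _))) room″)
            -- A gadget may be recoloured with `t`, since `verts` does not see the colour.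
            (λ { (_ , g) av → all (t , g) av })
    where
    min′ : M * length (part t K) ≤ length K
    min′ = subst (M * length (part t K) ≤_) (∑-part K) min
    room″ : length F' + 5 * length K + 5 ≤ n
    room″ = ℕ.≤-trans le room

theorem1p1 : ∀ (p d : ℕ) → Prime p → 1 ≤ d →
    ∀ (N M : ℕ) → IsNOf p d N → IsFOf p d M → N ≤ 5 * d * M
theorem1p1 p d pr 1≤d N M (_ , _ , N-least) (1≤M , fp , _) = N-least n (ℕ.≤-trans (s≤s z≤n) 3≤n) has-cycle
  where
  open Bases p d pr
  n = 5 * d * M
  3≤n : 3 ≤ n
  3≤n = ℕ.≤-trans (s≤s (s≤s (s≤s z≤n))) (ℕ.*-mono-≤ (ℕ.*-monoʳ-≤ 5 1≤d) 1≤M)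
  reorder : ∀ d M → 5 * (M * d) ≡ 5 * d * M
  reorder = solve-∀
  has-cycle : NProperty p d n
  has-cycle w with extend-basis [] tt
  -- The start is the empty set of forbidden vertices and a basis of the whole space, which spans
  -- every difference; the room required is then 5 M d.
  ... | C , ind , len = balanced-cycle (suc d) [] (C ++ []) (s≤s (ℕ.≤-reflexive len)) ind
        (ℕ.≤-reflexive (trans (cong (λ k → 5 * (M * k)) len) (reorder d M))) 3≤n
        (λ e _ → full-spans ind len _)
    where open Gadgets p d pr M 1≤M fp n w
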